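{- For every integer $s \geq 1$ and every integer $t \geq 1$, the linear threshold of $K_{s,t}'$ is at most $\sigma_s = 2 - 1/s$. Moreover, for every integer $s \geq 1$ and every real number $\sigma < \sigma_s$, there exists $t_0$ (depending on $s$ and $\sigma$) such that for all integers $t \geq t_0$, $\sigma$ is strictly less than the linear threshold of $K_{s,t}'$.
   Context: All bipartite graphs come with an ordered bipartition $(\text{left side}, \text{right side})$; we write $G=(U\sqcup V,E)$ with $U$ the left side and $V$ the right side. For bipartite graphs $H=(A\sqcup B, E_H)$ and $G=(U\sqcup V,E)$, a copy of $H$ in $G$ is an injective map sending $A$ into $U$ and $B$ into $V$ that maps edges of $H$ to edges of $G$. The linear threshold of a bipartite graph $H$ is the smallest real number $\sigma$ such that for every $\epsilon>0$ there exists $\delta$ such that every bipartite graph $G=(U\sqcup V,E)$ with $|V|\geq \epsilon|U|^\sigma$ and $|E|\geq \delta|V|$ contains a copy of $H$. The complete bipartite subdivision $K_{s,t}'$ is the bipartite graph with left side $\{u_1,\dots,u_s,v_1,\dots,v_t\}$, right side $\{w_{ij}: 1\le i\le s, 1\le j\le t\}$, and edges $u_iw_{ij}$ and $v_jw_{ij}$ for all $1\leq i\leq s$, $1\leq j\leq t$. -}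

module Defs where

open import Data.Nat as ℕ using (ℕ; zero; suc; NonZero)
open import Data.Integer as ℤ using (ℤ; +_; -[1+_])
open import Data.Rational as ℚ using (ℚ; _/_; _≤_; _<_; _*_; _-_; ↥_; ↧ₙ_; 1ℚ; 0ℚ)
open import Data.Fin using (Fin)
open import Data.Bool using (Bool; true; false)
open import Data.Sum using (_⊎_; inj₁; inj₂)
open import Data.Product using (_×_; _,_; Σ; ∃)
open import Function.Definitions using (Injective)
open import Relation.Binary.PropositionalEquality using (_≡_)
open import Relation.Nullary using (¬_)

record Pattern : Set₁ where
  field
    A : Set
    B : Set
    E : A → B → Set

BipGraph : ℕ → ℕ → Set
BipGraph m n = Fin m → Fin n → Bool

countRow : {n : ℕ} → (Fin n → Bool) → ℕ
countRow {zero} r = 0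
countRow {suc n} r with r Fin.zero
... | true  = suc (countRow (λ j → r (Fin.suc j)))
  where import Data.Fin as Fin
... | false = countRow (λ j → r (Fin.suc j))
  where import Data.Fin as Fin

edgeCount : {m n : ℕ} → BipGraph m n → ℕ
edgeCount {zero}  G = 0
edgeCount {suc m} G = countRow (G Fin.zero) ℕ.+ edgeCount (λ i → G (Fin.suc i))
  where import Data.Fin as Fin

record Copy (H : Pattern) {m n : ℕ} (G : BipGraph m n) : Set where
  open Pattern H
  field
    f      : A → Fin m
    g      : B → Fin n
    f-inj  : Injective _≡_ _≡_ f
    g-inj  : Injective _≡_ _≡_ g
    edges  : ∀ a b → E a b → G (f a) (g b) ≡ true

-- The complete bipartite subdivision K'_{s,t}:
-- left side {u_1..u_s} ⊔ {v_1..v_t}, right side {w_ij}, edges u_i w_ij and v_j w_ij.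
KsubEdge : (s t : ℕ) → Fin s ⊎ Fin t → Fin s × Fin t → Set
KsubEdge s t (inj₁ i) (i′ , j′) = i ≡ i′
KsubEdge s t (inj₂ j) (i′ , j′) = j ≡ j′

Ksub : ℕ → ℕ → Pattern
Ksub s t = record { A = Fin s ⊎ Fin t ; B = Fin s × Fin t ; E = KsubEdge s t }

_^ℚ_ : ℚ → ℕ → ℚ
x ^ℚ zero  = 1ℚ
x ^ℚ suc k = x * (x ^ℚ k)

ℕtoℚ : ℕ → ℚ
ℕtoℚ k = (+ k) / 1

-- "n ≥ ε · m^σ" for a rational exponent σ = p/q (q > 0, p ∈ ℤ), m ≥ 1, ε > 0, n ≥ 0,
-- written equivalently (raising both nonnegative sides to the q-th power) as
--   ε^q · m^p ≤ n^q            if p = k ≥ 0,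
--   ε^q ≤ n^q · m^(k+1)        if p = -(k+1).
AtLeastPow : (n : ℕ) (ε : ℚ) (m : ℕ) (σ : ℚ) → Set
AtLeastPow n ε m σ with ↥ σ
... | + k      = (ε ^ℚ (↧ₙ σ)) * (ℕtoℚ m ^ℚ k) ≤ (ℕtoℚ n ^ℚ (↧ₙ σ))
... | -[1+ k ] = (ε ^ℚ (↧ₙ σ)) ≤ (ℕtoℚ n ^ℚ (↧ₙ σ)) * (ℕtoℚ m ^ℚ suc k)

ThresholdHolds : Pattern → ℚ → Set
ThresholdHolds H σ =
  (ε : ℚ) → 0ℚ < ε →
  Σ ℚ λ δ →
    (m n : ℕ) (G : BipGraph m n) →
    1 ℕ.≤ m →
    AtLeastPow n ε m σ →
    δ * ℕtoℚ n ≤ ℕtoℚ (edgeCount G) →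
    Copy H G

-- "linear threshold of H ≤ σ"   (the threshold is the minimum σ for which ThresholdHolds H σ,
-- and the property is upward closed in σ)
LinThresholdAtMost : Pattern → ℚ → Set
LinThresholdAtMost H σ = ThresholdHolds H σ

LinThresholdGreater : Pattern → ℚ → Set
LinThresholdGreater H σ = ¬ ThresholdHolds H σ

sigma : (s : ℕ) → .{{NonZero s}} → ℚ
sigma s = ((+ 2) / 1) - ((+ 1) / s)

{-# OPTIONS --safe #-}
module Submission where

-- Upper bound. Call a pair of left vertices light if it has at most st common neighbours.
-- Any s + t left vertices without a light pair carry a copy of K'_{s,t}, with the w_ij chosen
-- greedily; so, without a copy, each neighbourhood N(w) is covered up to s + t vertices by a
-- matching M_w of light pairs. Lightness bounds the number of w that use the same pair, so the
-- union of the M_w is a graph on U with at least C |U|^(2 - 1/s) edges and contains K_{s,T} with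
-- T as large as we like. Label its edge x_i y_j by some w with x_i y_j in M_w. As M_w is a
-- matching, labels repeat only between different i and different j, and each y_j shares a label
-- with at most s² others; so t of the y_j can be chosen greedily with all labels distinct.
--
-- Lower bound. Let U consist of d classes of size M and let every w ∈ V pick one vertex in each
-- class: M^(d|V|) graphs with d|V| edges. A copy of K'_{s,t} prescribes 2st of the d|V| picks, so
-- if every graph had one, then M^(2st) ≤ |U|^(s+t) |V|^(st). This fails for |V| = |U|^σ,
-- d constant, and t, |U| large.

open import Defs
open import Data.Nat using (ℕ; _≤_; _≥_; NonZero)
open import Data.Rational using (ℚ; _<_)
open import Data.Product using (_×_; Σ)

open import Data.Nat as ℕ using (zero; suc; _+_; _*_; _∸_; _^_; _≤?_; _<?_; z≤n; s≤s)
open import Data.Nat.Properties hiding (_≟_)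
open import Data.Nat.Tactic.RingSolver using (solve-∀)
open import Data.Integer as ℤ using (+_; -[1+_]; ∣_∣)
import Data.Integer.Properties as ℤ
open import Data.Rational as ℚ using (mkℚ; ↥_; ↧_; ↧ₙ_; 0ℚ; 1ℚ; toℚᵘ)
import Data.Rational.Properties as ℚ
open import Data.Rational.Unnormalised as ℚᵘ using (mkℚᵘ; _≃_; *≤*)
import Data.Rational.Unnormalised.Properties as ℚᵘ
open import Algebra.Properties.Semiring.Sum +-*-semiring
  using (sum; sum-cong-≗; ∑-comm; ∑-distrib-+; *-distribˡ-sum; *-distribʳ-sum)
open import Data.Bool using (Bool; true; false; _∧_; _∨_; not; if_then_else_)
import Data.Bool.Properties as Bool
open import Data.Empty using (⊥; ⊥-elim)
open import Data.Fin as Fin using (Fin; zero; suc; _≟_; combine; remQuot; splitAt; join; finToFun; funToFin)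
import Data.Fin.Properties as Fin
open import Data.Fin.Properties using (any?)
open import Data.Product using (∃; ∃₂; _,_; proj₁; proj₂)
open import Data.Sum using (_⊎_; inj₁; inj₂; [_,_]′)
open import Data.Vec.Functional using (_∷_)
open import Function using (_∘_)
open import Function.Definitions using (Injective)
open import Relation.Binary.Definitions using (tri<; tri≈; tri>)
open import Relation.Binary.PropositionalEquality
open import Relation.Nullary using (¬_; Dec; yes; no; does)
open import Relation.Nullary.Decidable using (dec-true; _×-dec_; ¬?)

-- Rational inequalities as inequalities between natural numbers

/1-≃ : ∀ i → toℚᵘ (i ℚ./ 1) ≃ mkℚᵘ i 0
/1-≃ i = ℚ.toℚᵘ-fromℚᵘ (mkℚᵘ i 0)

ℕtoℚ-* : ∀ a b → ℕtoℚ (a * b) ≡ ℕtoℚ a ℚ.* ℕtoℚ b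
ℕtoℚ-* a b = ℚ.toℚᵘ-injective (begin
  toℚᵘ (ℕtoℚ (a * b))                 ≈⟨ /1-≃ (+ (a * b)) ⟩
  mkℚᵘ (+ (a * b)) 0                  ≡⟨ cong (λ z → mkℚᵘ z 0) (ℤ.pos-* a b) ⟩
  mkℚᵘ (+ a) 0 ℚᵘ.* mkℚᵘ (+ b) 0      ≈⟨ ℚᵘ.*-cong (/1-≃ (+ a)) (/1-≃ (+ b)) ⟨
  toℚᵘ (ℕtoℚ a) ℚᵘ.* toℚᵘ (ℕtoℚ b)    ≈⟨ ℚ.toℚᵘ-homo-* (ℕtoℚ a) (ℕtoℚ b) ⟨
  toℚᵘ (ℕtoℚ a ℚ.* ℕtoℚ b)            ∎)
  where open ℚᵘ.≃-Reasoning

ℕtoℚ-^ : ∀ a k → ℕtoℚ (a ^ k) ≡ ℕtoℚ a ^ℚ k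
ℕtoℚ-^ a zero    = refl
ℕtoℚ-^ a (suc k) = trans (ℕtoℚ-* a (a ^ k)) (cong (ℕtoℚ a ℚ.*_) (ℕtoℚ-^ a k))

≤-/1 : ∀ p k → ↥ p ℤ.≤ + k ℤ.* ↧ p → p ℚ.≤ ℕtoℚ k
≤-/1 p@record{} k h = ℚ.toℚᵘ-cancel-≤ (ℚᵘ.≤-trans (*≤* (subst₂ ℤ._≤_ (sym (ℤ.*-identityʳ _)) refl h))
                                 (ℚᵘ.≤-reflexive (ℚᵘ.≃-sym (/1-≃ (+ k)))))

ℕtoℚ-cancel-≤ : ∀ {a b} → ℕtoℚ a ℚ.≤ ℕtoℚ b → a ≤ b
ℕtoℚ-cancel-≤ {a} {b} h = ℤ.drop‿+≤+ (subst₂ ℤ._≤_ (ℤ.*-identityʳ (+ a)) (ℤ.*-identityʳ (+ b)) (ℚᵘ.drop-*≤* (begin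
  mkℚᵘ (+ a) 0      ≃⟨ /1-≃ (+ a) ⟨
  toℚᵘ (ℕtoℚ a)     ≤⟨ ℚ.toℚᵘ-mono-≤ h ⟩
  toℚᵘ (ℕtoℚ b)     ≃⟨ /1-≃ (+ b) ⟩
  mkℚᵘ (+ b) 0      ∎)))
  where open ℚᵘ.≤-Reasoning

ℕtoℚ-mono-≤ : ∀ {a b} → a ≤ b → ℕtoℚ a ℚ.≤ ℕtoℚ b
ℕtoℚ-mono-≤ {a} {b} h = ℚ.toℚᵘ-cancel-≤ (begin
  toℚᵘ (ℕtoℚ a)     ≃⟨ /1-≃ (+ a) ⟩
  mkℚᵘ (+ a) 0      ≤⟨ *≤* (ℤ.*-monoʳ-≤-nonNeg (+ 1) (ℤ.+≤+ h)) ⟩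
  mkℚᵘ (+ b) 0      ≃⟨ /1-≃ (+ b) ⟨
  toℚᵘ (ℕtoℚ b)     ∎)
  where open ℚᵘ.≤-Reasoning

0≤ℕtoℚ : ∀ a → 0ℚ ℚ.≤ ℕtoℚ a
0≤ℕtoℚ a = ℕtoℚ-mono-≤ {0} {a} z≤n

*-mono-≤-ℚ : ∀ {p q r s} → 0ℚ ℚ.≤ p → 0ℚ ℚ.≤ s → p ℚ.≤ q → r ℚ.≤ s → p ℚ.* r ℚ.≤ q ℚ.* s
*-mono-≤-ℚ {p} {q} {r} {s} 0≤p 0≤s p≤q r≤s =
  ℚ.≤-trans (ℚ.*-monoˡ-≤-nonNeg p {{ℚ.nonNegative 0≤p}} r≤s) (ℚ.*-monoʳ-≤-nonNeg s {{ℚ.nonNegative 0≤s}} p≤q)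

1≤^ℚ : ∀ {p} k → 1ℚ ℚ.≤ p → 1ℚ ℚ.≤ p ^ℚ k
1≤^ℚ zero h = ℚ.≤-refl
1≤^ℚ {p} (suc k) h = subst (ℚ._≤ p ℚ.* (p ^ℚ k)) (ℚ.*-identityˡ 1ℚ)
  (*-mono-≤-ℚ (0≤ℕtoℚ 1) (ℚ.≤-trans (0≤ℕtoℚ 1) (1≤^ℚ k h)) h (1≤^ℚ k h))

^ℚ-distribʳ-* : ∀ p r k → (p ℚ.* r) ^ℚ k ≡ (p ^ℚ k) ℚ.* (r ^ℚ k)
^ℚ-distribʳ-* p r zero    = sym (ℚ.*-identityˡ 1ℚ)
^ℚ-distribʳ-* p r (suc k) = begin
  (p ℚ.* r) ℚ.* ((p ℚ.* r) ^ℚ k)          ≡⟨ cong (p ℚ.* r ℚ.*_) (^ℚ-distribʳ-* p r k) ⟩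
  (p ℚ.* r) ℚ.* ((p ^ℚ k) ℚ.* (r ^ℚ k))   ≡⟨ ℚ.*-assoc p r _ ⟩
  p ℚ.* (r ℚ.* ((p ^ℚ k) ℚ.* (r ^ℚ k)))   ≡⟨ cong (p ℚ.*_) (trans (sym (ℚ.*-assoc r (p ^ℚ k) (r ^ℚ k)))
                                                  (trans (cong (ℚ._* (r ^ℚ k)) (ℚ.*-comm r (p ^ℚ k))) (ℚ.*-assoc (p ^ℚ k) r (r ^ℚ k)))) ⟩
  p ℚ.* ((p ^ℚ k) ℚ.* (r ℚ.* (r ^ℚ k)))   ≡⟨ ℚ.*-assoc p _ _ ⟨
  (p ^ℚ suc k) ℚ.* (r ^ℚ suc k)           ∎
  where open ≡-Reasoning

^-distribʳ-* : ∀ a b k → (a * b) ^ k ≡ a ^ k * b ^ k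
^-distribʳ-* a b zero    = refl
^-distribʳ-* a b (suc k) = trans (cong (a * b *_) (^-distribʳ-* a b k)) (interchange a b (a ^ k) (b ^ k))
  where
  interchange : ∀ a b x y → a * b * (x * y) ≡ a * x * (b * y)
  interchange = solve-∀

^-cancelˡ-≤ : ∀ q .{{_ : NonZero q}} {a b} → a ^ q ≤ b ^ q → a ≤ b
^-cancelˡ-≤ q h = ≮⇒≥ λ b<a → <⇒≱ (^-monoˡ-< q b<a) h

-- A positive rational times its denominator is its numerator, a positive integer.
0<⇒1≤*↧ : ∀ ε → 0ℚ ℚ.< ε → 1ℚ ℚ.≤ ℕtoℚ (↧ₙ ε) ℚ.* ε
0<⇒1≤*↧ ε@record{} 0<ε = ℚ.toℚᵘ-cancel-≤ (begin
  mkℚᵘ (+ 1) 0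
    ≤⟨ *≤* (subst₂ ℤ._≤_ refl (sym (ℤ.*-identityʳ (+ ↧ₙ ε ℤ.* ↥ ε))) (1≤ {↥ ε} (↧ₙ ε) (ℚ.drop-*<* 0<ε))) ⟩
  mkℚᵘ (+ ↧ₙ ε) 0 ℚᵘ.* toℚᵘ ε          ≃⟨ ℚᵘ.*-cong (/1-≃ (+ ↧ₙ ε)) ℚᵘ.≃-refl ⟨
  toℚᵘ (ℕtoℚ (↧ₙ ε)) ℚᵘ.* toℚᵘ ε       ≃⟨ ℚ.toℚᵘ-homo-* (ℕtoℚ (↧ₙ ε)) ε ⟨
  toℚᵘ (ℕtoℚ (↧ₙ ε) ℚ.* ε)             ∎)
  where
  open ℚᵘ.≤-Reasoning
  1≤ : ∀ {i} d → + 0 ℤ.* + d ℤ.< i ℤ.* + 1 → + 1 ℤ.* (+ 1 ℤ.* + d) ℤ.≤ + d ℤ.* i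
  1≤ {+ zero}   d (ℤ.+<+ ())
  1≤ {+ suc k}  d _ = subst₂ ℤ._≤_ (sym (trans (ℤ.*-identityˡ _) (ℤ.*-identityˡ _))) (ℤ.pos-* d (suc k)) (ℤ.+≤+ (m≤m*n d (suc k)))
  1≤ { -[1+ k ]} d ()

-- A crude natural upper bound that serves negative `p` as well.
≤-ceil : ∀ p → p ℚ.≤ ℕtoℚ ∣ ↥ p ∣
≤-ceil p = ≤-/1 p ∣ ↥ p ∣ (ℤ.≤-trans (i≤∣i∣ (↥ p))
  (subst (+ ∣ ↥ p ∣ ℤ.≤_) (ℤ.pos-* ∣ ↥ p ∣ (↧ₙ p)) (ℤ.+≤+ (m≤m*n _ (↧ₙ p)))))
  where
  i≤∣i∣ : ∀ i → i ℤ.≤ + ∣ i ∣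
  i≤∣i∣ (+ _)      = ℤ.≤-refl
  i≤∣i∣ -[1+ _ ]   = ℤ.-≤+

-- With s + 1 in place of s, σ is (2s + 1)/(s + 1). The cross-multiplied form avoids computing the
-- normalised fraction.
sigma-≃ : ∀ s → ↥ sigma (suc s) ℤ.* + suc s ≡ + (1 + 2 * s) ℤ.* ↧ sigma (suc s)
sigma-≃ s = trans (cong (λ z → ↥ sigma (suc s) ℤ.* (+ z)) (sym (*-identityˡ (suc s))))
  (trans (subst₂ (λ i j → i ℤ.* (+ (1 * suc s)) ≡ (+ 2 ℤ.* + suc s ℤ.+ -[1+ 0 ] ℤ.* + 1) ℤ.* j)
            (ℚ.↥ᵘ-toℚᵘ (sigma (suc s))) (ℚ.↧ᵘ-toℚᵘ (sigma (suc s))) (ℚᵘ.drop-*≡* sigma-≃ᵘ))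
         (cong (ℤ._* ↧ sigma (suc s)) numerator))
  where
  open ℚᵘ.≃-Reasoning
  sigma-≃ᵘ : toℚᵘ (sigma (suc s)) ≃ mkℚᵘ (+ 2) 0 ℚᵘ.- mkℚᵘ (+ 1) s
  sigma-≃ᵘ = begin
    toℚᵘ (sigma (suc s))
      ≈⟨ ℚ.toℚᵘ-homo-+ ((+ 2) ℚ./ 1) (ℚ.- ((+ 1) ℚ./ suc s)) ⟩
    toℚᵘ ((+ 2) ℚ./ 1) ℚᵘ.+ toℚᵘ (ℚ.- ((+ 1) ℚ./ suc s))
      ≈⟨ ℚᵘ.+-cong (/1-≃ (+ 2)) (ℚᵘ.≃-trans (ℚ.toℚᵘ-homo‿- ((+ 1) ℚ./ suc s)) (ℚᵘ.-‿cong (ℚ.toℚᵘ-fromℚᵘ (mkℚᵘ (+ 1) s)))) ⟩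
    mkℚᵘ (+ 2) 0 ℚᵘ.- mkℚᵘ (+ 1) s ∎
  numerator : + 2 ℤ.* + suc s ℤ.+ -[1+ 0 ] ℤ.* + 1 ≡ + (1 + 2 * s)
  numerator = cong (ℤ._+ -[1+ 0 ]) (trans (sym (ℤ.pos-* 2 (suc s))) (cong +_ (two s)))
    where
    two : ∀ s → 2 * suc s ≡ 2 + 2 * s
    two = solve-∀

sigma-fraction : ∀ s → Σ ℕ λ k → ↥ sigma (suc s) ≡ + k × k * suc s ≡ (1 + 2 * s) * ↧ₙ sigma (suc s)
sigma-fraction s with ↥ sigma (suc s) | sigma-≃ s
... | + k      | h = k , refl , ℤ.+-injective (trans (ℤ.pos-* k (suc s)) (trans h (sym (ℤ.pos-* (1 + 2 * s) (↧ₙ sigma (suc s))))))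
... | -[1+ k ] | h with () ← trans (sym (ℤ.pos-* (1 + 2 * s) (↧ₙ sigma (suc s)))) (sym h)

AtLeastPow-+ : ∀ n ε m σ {k} → ↥ σ ≡ + k →
  AtLeastPow n ε m σ ≡ ((ε ^ℚ (↧ₙ σ)) ℚ.* (ℕtoℚ m ^ℚ k) ℚ.≤ (ℕtoℚ n ^ℚ (↧ₙ σ)))
AtLeastPow-+ n ε m σ eq rewrite eq = refl

-- The denominator of `ε` is at least 1/ε, so multiplying by its `q`-th power removes `ε` and leaves
-- natural numbers.
clear-ε : ∀ n ε m k q → 0ℚ ℚ.< ε → (ε ^ℚ q) ℚ.* (ℕtoℚ m ^ℚ k) ℚ.≤ (ℕtoℚ n ^ℚ q) → m ^ k ≤ (↧ₙ ε * n) ^ q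
clear-ε n ε m k q 0<ε h = ℕtoℚ-cancel-≤ (begin
  ℕtoℚ (m ^ k)                           ≡⟨ ℚ.*-identityˡ _ ⟨
  1ℚ ℚ.* ℕtoℚ (m ^ k)
    ≤⟨ ℚ.*-monoʳ-≤-nonNeg (ℕtoℚ (m ^ k)) {{ℚ.nonNegative (0≤ℕtoℚ (m ^ k))}} (1≤^ℚ q (0<⇒1≤*↧ ε 0<ε)) ⟩
  ((ℕtoℚ d ℚ.* ε) ^ℚ q) ℚ.* ℕtoℚ (m ^ k)  ≡⟨ cong₂ ℚ._*_ (^ℚ-distribʳ-* (ℕtoℚ d) ε q) (ℕtoℚ-^ m k) ⟩
  (ℕtoℚ d ^ℚ q) ℚ.* (ε ^ℚ q) ℚ.* (ℕtoℚ m ^ℚ k)   ≡⟨ ℚ.*-assoc (ℕtoℚ d ^ℚ q) _ _ ⟩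
  (ℕtoℚ d ^ℚ q) ℚ.* ((ε ^ℚ q) ℚ.* (ℕtoℚ m ^ℚ k))
    ≤⟨ ℚ.*-monoˡ-≤-nonNeg (ℕtoℚ d ^ℚ q) {{ℚ.nonNegative (subst (0ℚ ℚ.≤_) (ℕtoℚ-^ d q) (0≤ℕtoℚ (d ^ q)))}} h ⟩
  (ℕtoℚ d ^ℚ q) ℚ.* (ℕtoℚ n ^ℚ q)        ≡⟨ cong₂ ℚ._*_ (ℕtoℚ-^ d q) (ℕtoℚ-^ n q) ⟨
  ℕtoℚ (d ^ q) ℚ.* ℕtoℚ (n ^ q)          ≡⟨ ℕtoℚ-* (d ^ q) (n ^ q) ⟨
  ℕtoℚ (d ^ q * n ^ q)                   ≡⟨ cong ℕtoℚ (^-distribʳ-* d n q) ⟨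
  ℕtoℚ ((d * n) ^ q)                     ∎)
  where
  open ℚ.≤-Reasoning
  d = ↧ₙ ε

-- The normalised exponent k/q equals (2s + 1)/(s + 1). Raising to the power `suc s` trades one
-- denominator for the other, and a `q`-th root finishes.
AtLeastPow-sigma : ∀ s n ε m → 0ℚ ℚ.< ε → AtLeastPow n ε m (sigma (suc s)) → m ^ (1 + 2 * s) ≤ (↧ₙ ε * n) ^ suc s
AtLeastPow-sigma s n ε m 0<ε h with sigma-fraction s
... | k , num , frac = ^-cancelˡ-≤ q (begin
  (m ^ (1 + 2 * s)) ^ q     ≡⟨ ^-*-assoc m (1 + 2 * s) q ⟩
  m ^ ((1 + 2 * s) * q)     ≡⟨ cong (m ^_) frac ⟨
  m ^ (k * suc s)           ≡⟨ ^-*-assoc m k (suc s) ⟨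
  (m ^ k) ^ suc s           ≤⟨ ^-monoˡ-≤ (suc s) (clear-ε n ε m k q 0<ε (subst (λ X → X) (AtLeastPow-+ n ε m (sigma (suc s)) num) h)) ⟩
  (ν ^ q) ^ suc s           ≡⟨ ^-*-assoc ν q (suc s) ⟩
  ν ^ (q * suc s)           ≡⟨ cong (ν ^_) (*-comm q (suc s)) ⟩
  ν ^ (suc s * q)           ≡⟨ ^-*-assoc ν (suc s) q ⟨
  (ν ^ suc s) ^ q           ∎)
  where
  open ≤-Reasoning
  q = ↧ₙ sigma (suc s)
  ν = ↧ₙ ε * n

-- Finite sums and counting

sum-mono : ∀ {n} {f g : Fin n → ℕ} → (∀ i → f i ≤ g i) → sum f ≤ sum g
sum-mono {zero}  f≤g = z≤n
sum-mono {suc n} f≤g = +-mono-≤ (f≤g zero) (sum-mono (f≤g ∘ suc))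

sum-const : ∀ n c → sum {n} (λ _ → c) ≡ n * c
sum-const zero    c = refl
sum-const (suc n) c = cong (λ z → c + z) (sum-const n c)

term≤sum : ∀ {n} (f : Fin n → ℕ) i → f i ≤ sum f
term≤sum f zero    = m≤m+n (f zero) _
term≤sum f (suc i) = ≤-trans (term≤sum (f ∘ suc) i) (m≤n+m _ (f zero))

sum<⇒∃< : ∀ {n} {f g : Fin n → ℕ} → sum f ℕ.< sum g → ∃ λ i → f i ℕ.< g i
sum<⇒∃< {suc n} {f} {g} h with f zero <? g zero
... | yes f₀<g₀ = zero , f₀<g₀
... | no  f₀≮g₀ with sum<⇒∃< {f = f ∘ suc} {g ∘ suc}
                     (≰⇒> λ h′ → <⇒≱ h (+-mono-≤ (≮⇒≥ f₀≮g₀) h′))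
...   | i , fᵢ<gᵢ = suc i , fᵢ<gᵢ

ind : Bool → ℕ
ind b = if b then 1 else 0

count : ∀ {n} → (Fin n → Bool) → ℕ
count p = sum (ind ∘ p)

countRow≡count : ∀ {n} (r : Fin n → Bool) → countRow r ≡ count r
countRow≡count {zero}  r = refl
countRow≡count {suc n} r with r zero
... | true  = cong suc (countRow≡count (r ∘ suc))
... | false = countRow≡count (r ∘ suc)

edgeCount≡sum : ∀ {m n} (G : BipGraph m n) → edgeCount G ≡ sum (λ x → count (G x))
edgeCount≡sum {zero}  G = refl
edgeCount≡sum {suc m} G = cong₂ _+_ (countRow≡count (G zero)) (edgeCount≡sum (G ∘ suc))

witness : ∀ {A : Set} (a? : Dec A) → does a? ≡ true → A
witness (yes a) _ = a

∧-elim : ∀ {a b} → a ∧ b ≡ true → a ≡ true × b ≡ true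
∧-elim {true} {true} _ = refl , refl

ind-mono : ∀ {a b} → (a ≡ true → b ≡ true) → ind a ≤ ind b
ind-mono {false}        _ = z≤n
ind-mono {true} {true}  _ = ≤-refl
ind-mono {true} {false} h with () ← h refl

count-mono : ∀ {n} {p q : Fin n → Bool} → (∀ i → p i ≡ true → q i ≡ true) → count p ≤ count q
count-mono h = sum-mono (λ i → ind-mono (h i))

count-positive⇒∃ : ∀ {n} {p : Fin n → Bool} → 0 ℕ.< count p → ∃ λ i → p i ≡ true
count-positive⇒∃ {n} {p} h with sum<⇒∃< {f = λ _ → 0} (subst (ℕ._< count p) (sym (trans (sum-const n 0) (*-zeroʳ n))) h)
... | i , 0<pᵢ with p i in eq
...   | true = i , eq

count-none : ∀ {n} {p : Fin n → Bool} → (∀ i → p i ≢ true) → count p ≡ 0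
count-none {n} {p} none with count p in eq
... | zero  = refl
... | suc _ with i , pᵢ ← count-positive⇒∃ {p = p} (subst (0 ℕ.<_) (sym eq) (s≤s z≤n)) = ⊥-elim (none i pᵢ)

count-unique : ∀ {n} {p : Fin n → Bool} → (∀ i j → p i ≡ true → p j ≡ true → i ≡ j) → count p ≤ 1
count-unique {zero}      _ = z≤n
count-unique {suc n} {p} unique with p zero in p₀
... | false = count-unique λ i j pᵢ pⱼ → Fin.suc-injective (unique (suc i) (suc j) pᵢ pⱼ)
... | true  = s≤s (≤-reflexive (count-none λ i pᵢ → case-0 (unique zero (suc i) p₀ pᵢ)))
  where
  case-0 : ∀ {i : Fin n} → zero ≡ suc i → ⊥
  case-0 ()

count-≟ : ∀ {n} (a : Fin n) → count (λ i → does (i ≟ a)) ≡ 1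
count-≟ a = ≤-antisym
  (count-unique λ i j i≡a j≡a → trans (witness (i ≟ a) i≡a) (sym (witness (j ≟ a) j≡a)))
  (subst (_≤ count (λ i → does (i ≟ a))) (cong ind (dec-true (a ≟ a) refl)) (term≤sum _ a))

count-∖ : ∀ {n} (p q : Fin n → Bool) → count p ≤ count (λ i → p i ∧ not (q i)) + count q
count-∖ p q = ≤-trans (sum-mono λ i → pointwise (p i) (q i)) (≤-reflexive (∑-distrib-+ (λ i → ind (p i ∧ not (q i))) (ind ∘ q)))
  where
  pointwise : ∀ a b → ind a ≤ ind (a ∧ not b) + ind b
  pointwise false _     = z≤n
  pointwise true  true  = ≤-refl
  pointwise true  false = ≤-refl

count-∨ : ∀ {n} (p q : Fin n → Bool) → count (λ i → p i ∨ q i) ≤ count p + count q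
count-∨ p q = ≤-trans (sum-mono λ i → pointwise (p i) (q i)) (≤-reflexive (∑-distrib-+ (ind ∘ p) (ind ∘ q)))
  where
  pointwise : ∀ a b → ind (a ∨ b) ≤ ind a + ind b
  pointwise false _ = ≤-refl
  pointwise true  _ = s≤s z≤n

-- Choosing `a` for the first index costs every later candidate set at most `κ` elements, which the
-- margin `k * κ` pays for. Conflicts are controlled only from earlier to later choices, so `conf`
-- may be asymmetric.
greedy : ∀ k {N κ} (C : Fin k → Fin N → Bool) (conf : Fin N → Fin N → Bool) →
  (∀ a → count (conf a) ≤ κ) → (∀ i → k * κ ℕ.< count (C i)) →
  Σ (Fin k → Fin N) λ c → (∀ i → C i (c i) ≡ true) × (∀ i j → i Fin.< j → conf (c i) (c j) ≡ false)
greedy zero C conf conf≤κ C-large = (λ ()) , (λ ()) , λ ()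
greedy (suc k) {N} {κ} C conf conf≤κ C-large
  with a , Ca ← count-positive⇒∃ {p = C zero} (≤-<-trans z≤n (C-large zero))
  with c , Cc , free ← greedy k (λ i b → C (suc i) b ∧ not (conf a b)) conf conf≤κ
         (λ i → +-cancelˡ-< κ _ _ (<-≤-trans (C-large (suc i))
           (≤-trans (count-∖ (C (suc i)) (conf a))
             (≤-trans (+-monoʳ-≤ _ (conf≤κ a)) (≤-reflexive (+-comm _ κ))))))
  = choice , valid , avoid
  where
  choice : Fin (suc k) → Fin N
  choice zero    = a
  choice (suc i) = c i
  valid : ∀ i → C i (choice i) ≡ true
  valid zero    = Ca
  valid (suc i) = proj₁ (∧-elim (Cc i))
  avoid : ∀ i j → i Fin.< j → conf (choice i) (choice j) ≡ false
  avoid zero    (suc j) _         = trans (sym (Bool.not-involutive _)) (cong not (proj₂ (∧-elim (Cc j))))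
  avoid (suc i) (suc j) (s≤s i<j) = free i j i<j

-- Greedy choice with equality as the conflict, hence `κ = 1`.
distinct-representatives : ∀ k {N} (C : Fin k → Fin N → Bool) → (∀ i → k ℕ.< count (C i)) →
  Σ (Fin k → Fin N) λ c → (∀ i → C i (c i) ≡ true) × Injective _≡_ _≡_ c
distinct-representatives k {N} C C-large
  with c , Cc , free ← greedy k {κ = 1} C (λ a b → does (b ≟ a)) (λ a → ≤-reflexive (count-≟ a))
         (λ i → subst (ℕ._< count (C i)) (sym (*-identityʳ k)) (C-large i))
  = c , Cc , injective
  where
  absurd : ∀ i j → i Fin.< j → c j ≢ c i
  absurd i j i<j cⱼ≡cᵢ with () ← trans (sym (dec-true (c j ≟ c i) cⱼ≡cᵢ)) (free i j i<j)
  injective : Injective _≡_ _≡_ c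
  injective {i} {j} cᵢ≡cⱼ with Fin.<-cmp i j
  ... | tri< i<j _ _ = ⊥-elim (absurd i j i<j (sym cᵢ≡cⱼ))
  ... | tri≈ _ i≡j _ = i≡j
  ... | tri> _ _ j<i = ⊥-elim (absurd j i j<i cᵢ≡cⱼ)

-- The Kővári–Sós–Turán argument

∷-injective : ∀ {r a} x₀ (x : Fin r → Fin a) → Injective _≡_ _≡_ x → (∀ i → x i ≢ x₀) → Injective _≡_ _≡_ (x₀ ∷ x)
∷-injective x₀ x x-inj x≢x₀ {zero}  {zero}  _  = refl
∷-injective x₀ x x-inj x≢x₀ {zero}  {suc j} eq = ⊥-elim (x≢x₀ j (sym eq))
∷-injective x₀ x x-inj x≢x₀ {suc i} {zero}  eq = ⊥-elim (x≢x₀ i eq)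
∷-injective x₀ x x-inj x≢x₀ {suc i} {suc j} eq = cong suc (x-inj eq)

-- Induction on `r`, choosing the `x i` one at a time. The sum of `β y ^ r` over common neighbours
-- replaces the usual binomial count of stars; averaging over `a` vertices divides its bound by `a`
-- and lowers the exponent by one, until the sum counts `Y′`. `β` stays fixed, and the surplus `r`
-- in the degrees pays for deleting each chosen vertex.
kővári–sós–turán : ∀ {a b} r T (A : Fin a → Fin b → Bool) (Y : Fin b → Bool) (β : Fin b → ℕ) → 1 ≤ a → 1 ≤ T →
  (∀ y → Y y ≡ true → β y + r ≤ count (λ x → A x y)) →
  T * a ^ r ≤ sum (λ y → ind (Y y) * β y ^ r) →
  Σ (Fin r → Fin a) λ x → Σ (Fin b → Bool) λ Y′ →
    Injective _≡_ _≡_ x × T ≤ count Y′ × (∀ y → Y′ y ≡ true → Y y ≡ true × (∀ i → A (x i) y ≡ true))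
kővári–sós–turán zero T A Y β 1≤a 1≤T _ large =
  (λ ()) , Y , (λ { {()} }) ,
  subst₂ _≤_ (*-identityʳ T) (sum-cong-≗ (λ y → *-identityʳ (ind (Y y)))) large ,
  λ y Yy → Yy , λ ()
kővári–sós–turán {a} {b} (suc r) T A Y β 1≤a 1≤T degree large
  = let
      -- Averaging yields a strict inequality, hence the bound lowered by one; the subtraction is
      -- exact because `T * a ^ r` is positive.
      x₀ , x₀-large = sum<⇒∃< {f = λ _ → T * a ^ r ∸ 1} {λ x → sum (λ y → ind (Y y ∧ A x y) * β y ^ r)} average
      x , Y′ , x-inj , Y′-large , Y′-adj = kővári–sós–turán r T
         -- Deleting `x₀` from the graph keeps the later choices distinct from it.
         (λ x y → A x y ∧ not (does (x ≟ x₀))) (λ y → Y y ∧ A x₀ y) β 1≤a 1≤T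
         (λ y Y₁y → degree₁ x₀ y (proj₁ (∧-elim Y₁y)))
         (≤-trans (m≤n+m∸n (T * a ^ r) 1) x₀-large)
    in x₀ ∷ x , Y′ , ∷-injective x₀ x x-inj (x≢x₀ x₀ x Y′-large λ y Y′y i → proj₂ (∧-elim {A (x i) y} (proj₂ (Y′-adj y Y′y) i))) ,
    Y′-large , λ y Y′y →
      proj₁ (∧-elim (proj₁ (Y′-adj y Y′y))) ,
      λ { zero    → proj₂ (∧-elim {Y y} (proj₁ (Y′-adj y Y′y)))
        ; (suc i) → proj₁ (∧-elim (proj₂ (Y′-adj y Y′y) i)) }
  where
  open ≤-Reasoning
  1≤Ta^r : 1 ≤ T * a ^ r
  1≤Ta^r = *-mono-≤ 1≤T (m^n>0 a {{ℕ.>-nonZero 1≤a}} r)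

  pointwise : ∀ y → ind (Y y) * (β y * β y ^ r) ≤ sum (λ x → ind (Y y ∧ A x y) * β y ^ r)
  pointwise y with Y y in Yy
  ... | false = z≤n
  ... | true  = begin
    β y * β y ^ r + 0                      ≡⟨ +-identityʳ _ ⟩
    β y * β y ^ r                          ≤⟨ *-monoˡ-≤ (β y ^ r) (≤-trans (m≤m+n (β y) (suc r)) (degree y Yy)) ⟩
    count (λ x → A x y) * β y ^ r          ≡⟨ *-distribʳ-sum (β y ^ r) (λ x → ind (A x y)) ⟩
    sum (λ x → ind (A x y) * β y ^ r)      ∎

  average : sum {a} (λ _ → T * a ^ r ∸ 1) ℕ.< sum (λ x → sum (λ y → ind (Y y ∧ A x y) * β y ^ r))
  average = begin-strict
    sum {a} (λ _ → T * a ^ r ∸ 1)                          ≡⟨ sum-const a _ ⟩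
    a * (T * a ^ r ∸ 1)                                    <⟨ *-monoʳ-< a {{ℕ.>-nonZero 1≤a}} (∸-monoʳ-< {T * a ^ r} {1} {0} (s≤s z≤n) 1≤Ta^r) ⟩
    a * (T * a ^ r)                                        ≡⟨ swap a T (a ^ r) ⟩
    T * a ^ suc r                                          ≤⟨ large ⟩
    sum (λ y → ind (Y y) * β y ^ suc r)                    ≤⟨ sum-mono pointwise ⟩
    sum (λ y → sum (λ x → ind (Y y ∧ A x y) * β y ^ r))    ≡⟨ ∑-comm (λ y x → ind (Y y ∧ A x y) * β y ^ r) ⟩
    sum (λ x → sum (λ y → ind (Y y ∧ A x y) * β y ^ r))    ∎
    where
    swap : ∀ a T z → a * (T * z) ≡ T * (a * z)
    swap = solve-∀

  degree₁ : ∀ x₀ y → Y y ≡ true → β y + r ≤ count (λ x → A x y ∧ not (does (x ≟ x₀)))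
  degree₁ x₀ y Yy = +-cancelʳ-≤ 1 _ _ (begin
    β y + r + 1       ≡⟨ trans (+-assoc (β y) r 1) (cong (λ z → β y + z) (+-comm r 1)) ⟩
    β y + suc r       ≤⟨ degree y Yy ⟩
    count (λ x → A x y)  ≤⟨ count-∖ (λ x → A x y) (λ x → does (x ≟ x₀)) ⟩
    count (λ x → A x y ∧ not (does (x ≟ x₀))) + count (λ x → does (x ≟ x₀))  ≡⟨ cong (λ z → count (λ x → A x y ∧ not (does (x ≟ x₀))) + z) (count-≟ x₀) ⟩
    count (λ x → A x y ∧ not (does (x ≟ x₀))) + 1  ∎)

  -- `x₀` is isolated in the reduced graph, whereas every `x i` has a neighbour there because
  -- `1 ≤ T` makes `Y′` nonempty.
  x≢x₀ : ∀ x₀ (x : Fin r → Fin a) {Y′ : Fin b → Bool} → T ≤ count Y′ →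
    (∀ y → Y′ y ≡ true → ∀ i → not (does (x i ≟ x₀)) ≡ true) → ∀ i → x i ≢ x₀
  x≢x₀ x₀ x {Y′} T≤Y′ avoid i xᵢ≡x₀ with y , Y′y ← count-positive⇒∃ {p = Y′} (≤-trans 1≤T T≤Y′)
    with () ← trans (cong not (sym (dec-true (x i ≟ x₀) xᵢ≡x₀))) (avoid y Y′y i)

-- Matchings of light pairs

module _ (s t : ℕ) {m n : ℕ} (G : BipGraph m n) where

  codegree : Fin m → Fin m → ℕ
  codegree x y = count (λ w → G x w ∧ G y w)

  -- Each of the `s * t` pairs (u_i, v_j) has more than `s * t` common neighbours, so distinct
  -- representatives of these sets can serve as the w_ij.
  clique⇒copy : (z : Fin (s + t) → Fin m) → Injective _≡_ _≡_ z →
    (∀ a b → a ≢ b → s * t ℕ.< codegree (z a) (z b)) → Copy (Ksub s t) G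
  clique⇒copy z z-inj heavy
    = let c , Cc , c-inj = distinct-representatives (s * t)
           (λ k w → G (z (proj₁ (remQuot {s} t k) Fin.↑ˡ t)) w ∧ G (z (s Fin.↑ʳ proj₂ (remQuot {s} t k))) w)
           (λ k → heavy _ _ (↑ˡ≢↑ʳ _ _))
    in record
    { f     = z ∘ join s t
    ; g     = λ (i , j) → c (combine i j)
    ; f-inj = λ {u} {v} fu≡fv → join-injective u v (z-inj fu≡fv)
    ; g-inj = λ { {i , j} {i′ , j′} gw≡gw′ → cong₂ _,_ (proj₁ (Fin.combine-injective i j i′ j′ (c-inj gw≡gw′)))
                                                     (proj₂ (Fin.combine-injective i j i′ j′ (c-inj gw≡gw′))) }
    ; edges = λ { (inj₁ i) (.i , j) refl → subst (λ ij → G (z (proj₁ ij Fin.↑ˡ t)) (c (combine i j)) ≡ true)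
                    (Fin.remQuot-combine i j) (proj₁ (∧-elim (Cc (combine i j))))
                ; (inj₂ j) (i , .j) refl → subst (λ ij → G (z (s Fin.↑ʳ proj₂ ij)) (c (combine i j)) ≡ true)
                    (Fin.remQuot-combine i j) (proj₂ (∧-elim {G (z (proj₁ (remQuot {s} t (combine i j)) Fin.↑ˡ t)) _} (Cc (combine i j)))) }
    }
    where
    join-injective : ∀ u v → join s t u ≡ join s t v → u ≡ v
    join-injective u v eq = trans (sym (Fin.splitAt-join s t u)) (trans (cong (Fin.splitAt s) eq) (Fin.splitAt-join s t v))
    ↑ˡ≢↑ʳ : ∀ (i : Fin s) (j : Fin t) → i Fin.↑ˡ t ≢ s Fin.↑ʳ j
    ↑ˡ≢↑ʳ i j eq with () ← join-injective (inj₁ i) (inj₂ j) eq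

  light-pair : (z : Fin (s + t) → Fin m) → Injective _≡_ _≡_ z →
    Copy (Ksub s t) G ⊎ ∃₂ λ a b → a ≢ b × codegree (z a) (z b) ≤ s * t
  light-pair z z-inj with any? (λ a → any? (λ b → ¬? (a ≟ b) ×-dec codegree (z a) (z b) ≤? s * t))
  ... | yes light = inj₂ light
  ... | no ¬light = inj₁ (clique⇒copy z z-inj λ a b a≢b → ≰⇒> λ h → ¬light (a , b , a≢b , h))

  pairs : (Fin m → Fin m → Bool) → ℕ
  pairs P = sum (λ x → count (P x))

  -- Pairs are stored with an orientation, so that the union of the matchings is a bipartite graph
  -- between two copies of the left side. In `large`, the factor 2 counts both ends of a pair, and
  -- `s + t` bounds the vertices left over.
  record LightMatching (S : Fin m → Bool) : Set where
    field
      P            : Fin m → Fin m → Bool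
      inside       : ∀ {x y} → P x y ≡ true → S x ≡ true × S y ≡ true
      irreflexive  : ∀ {x y} → P x y ≡ true → x ≢ y
      light        : ∀ {x y} → P x y ≡ true → codegree x y ≤ s * t
      left-unique  : ∀ {x x′ y} → P x y ≡ true → P x′ y ≡ true → x ≡ x′
      right-unique : ∀ {x y y′} → P x y ≡ true → P x y′ ≡ true → y ≡ y′
      large        : count S ≤ 2 * pairs P + (s + t)

  _∖⟨_,_⟩ : (Fin m → Bool) → Fin m → Fin m → Fin m → Bool
  (S ∖⟨ x , y ⟩) z = S z ∧ not (does (z ≟ x) ∨ does (z ≟ y))

  ∖-elim : ∀ S {x y z} → (S ∖⟨ x , y ⟩) z ≡ true → S z ≡ true × z ≢ x × z ≢ y
  ∖-elim S {x} {y} {z} h with S z | z ≟ x | z ≟ y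
  ... | true | no z≢x | no z≢y = refl , z≢x , z≢y

  ∖-decreases : ∀ S {x y} → S x ≡ true → count (S ∖⟨ x , y ⟩) ℕ.< count S
  ∖-decreases S {x} {y} Sx = begin
    1 + count (S ∖⟨ x , y ⟩)                                    ≡⟨ cong (_+ count (S ∖⟨ x , y ⟩)) (sym (count-≟ x)) ⟩
    count (λ z → does (z ≟ x)) + count (S ∖⟨ x , y ⟩)           ≡⟨ ∑-distrib-+ (λ z → ind (does (z ≟ x))) (ind ∘ (S ∖⟨ x , y ⟩)) ⟨
    sum (λ z → ind (does (z ≟ x)) + ind ((S ∖⟨ x , y ⟩) z))     ≤⟨ sum-mono pointwise ⟩
    count S                                                     ∎
    where
    open ≤-Reasoning
    pointwise : ∀ z → ind (does (z ≟ x)) + ind ((S ∖⟨ x , y ⟩) z) ≤ ind (S z)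
    pointwise z with z ≟ x
    ... | yes refl rewrite Sx = ≤-refl
    ... | no _ = ind-mono (λ h → proj₁ (∧-elim h))

  ∖-size : ∀ S x y → count S ≤ count (S ∖⟨ x , y ⟩) + 2
  ∖-size S x y = ≤-trans (count-∖ S (λ z → does (z ≟ x) ∨ does (z ≟ y)))
    (+-monoʳ-≤ _ (≤-trans (count-∨ (λ z → does (z ≟ x)) (λ z → does (z ≟ y))) (≤-reflexive (cong₂ _+_ (count-≟ x) (count-≟ y)))))

  no-pairs : ∀ {S} → count S ≤ s + t → LightMatching S
  no-pairs {S} small = record
    { P = λ _ _ → false ; inside = λ () ; irreflexive = λ () ; light = λ ()
    ; left-unique = λ () ; right-unique = λ () ; large = ≤-trans small (m≤n+m (s + t) (2 * pairs (λ _ _ → false))) }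

  add-pair : ∀ {S x y} → S x ≡ true → S y ≡ true → x ≢ y → codegree x y ≤ s * t →
    LightMatching (S ∖⟨ x , y ⟩) → LightMatching S
  add-pair {S} {x} {y} Sx Sy x≢y xy-light M = record
    { P = P⁺
    ; inside = λ h → [ (λ Pab → proj₁ (∖-elim S (proj₁ (inside Pab))) , proj₁ (∖-elim S (proj₂ (inside Pab))))
                     , (λ { (refl , refl) → Sx , Sy }) ]′ (P⁺-elim h)
    ; irreflexive = λ h → [ irreflexive , (λ { (refl , refl) → x≢y }) ]′ (P⁺-elim h)
    ; light = λ h → [ light , (λ { (refl , refl) → xy-light }) ]′ (P⁺-elim h)
    ; left-unique = left-unique⁺
    ; right-unique = right-unique⁺
    ; large = begin
        count S                             ≤⟨ ∖-size S x y ⟩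
        count (S ∖⟨ x , y ⟩) + 2            ≤⟨ +-monoˡ-≤ 2 large ⟩
        2 * pairs P + (s + t) + 2           ≡⟨ shuffle (pairs P) (s + t) ⟩
        2 * (pairs P + 1) + (s + t)         ≤⟨ +-monoˡ-≤ (s + t) (*-monoʳ-≤ 2 pairs-P⁺) ⟩
        2 * pairs P⁺ + (s + t)              ∎ }
    where
    open LightMatching M
    open ≤-Reasoning
    shuffle : ∀ p q → 2 * p + q + 2 ≡ 2 * (p + 1) + q
    shuffle = solve-∀

    P⁺ : Fin m → Fin m → Bool
    P⁺ a b = P a b ∨ (does (a ≟ x) ∧ does (b ≟ y))

    P⁺-elim : ∀ {a b} → P⁺ a b ≡ true → P a b ≡ true ⊎ (a ≡ x × b ≡ y)
    P⁺-elim {a} {b} h with P a b | a ≟ x | b ≟ y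
    ... | true  | _       | _       = inj₁ refl
    ... | false | yes a≡x | yes b≡y = inj₂ (a≡x , b≡y)

    left-unique⁺ : ∀ {a a′ b} → P⁺ a b ≡ true → P⁺ a′ b ≡ true → a ≡ a′
    left-unique⁺ h h′ with P⁺-elim h | P⁺-elim h′
    ... | inj₁ p             | inj₁ p′            = left-unique p p′
    ... | inj₁ p             | inj₂ (refl , refl) = ⊥-elim (proj₂ (proj₂ (∖-elim S (proj₂ (inside p)))) refl)
    ... | inj₂ (refl , refl) | inj₁ p′            = ⊥-elim (proj₂ (proj₂ (∖-elim S (proj₂ (inside p′)))) refl)
    ... | inj₂ (refl , _)    | inj₂ (refl , _)    = refl

    right-unique⁺ : ∀ {a b b′} → P⁺ a b ≡ true → P⁺ a b′ ≡ true → b ≡ b′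
    right-unique⁺ h h′ with P⁺-elim h | P⁺-elim h′
    ... | inj₁ p             | inj₁ p′            = right-unique p p′
    ... | inj₁ p             | inj₂ (refl , refl) = ⊥-elim (proj₁ (proj₂ (∖-elim S (proj₁ (inside p)))) refl)
    ... | inj₂ (refl , refl) | inj₁ p′            = ⊥-elim (proj₁ (proj₂ (∖-elim S (proj₁ (inside p′)))) refl)
    ... | inj₂ (_ , refl)    | inj₂ (_ , refl)    = refl

    -- `P` lives on `S` without `x` and `y`, so the new pair is not in it already and counts in
    -- full.
    disjoint : ∀ a b → ind (P a b) + ind (does (a ≟ x)) * ind (does (b ≟ y)) ≤ ind (P⁺ a b)
    disjoint a b with P a b in Pab | a ≟ x | b ≟ y
    ... | true  | yes refl | _       = ⊥-elim (proj₁ (proj₂ (∖-elim S (proj₁ (inside Pab)))) refl)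
    ... | true  | no _     | _       = ≤-refl
    ... | false | yes _    | yes _   = ≤-refl
    ... | false | yes _    | no _    = ≤-refl
    ... | false | no _     | _       = z≤n

    pairs-P⁺ : pairs P + 1 ≤ pairs P⁺
    pairs-P⁺ = begin
      pairs P + 1                                                              ≡⟨ cong (λ z → pairs P + z) (sym (count-≟ x)) ⟩
      pairs P + count (λ a → does (a ≟ x))                                     ≡⟨ cong (λ z → pairs P + z) (sum-cong-≗ row) ⟩
      pairs P + sum (λ a → sum (λ b → ind (does (a ≟ x)) * ind (does (b ≟ y))))   ≡⟨ ∑-distrib-+ (λ a → count (P a)) _ ⟨
      sum (λ a → count (P a) + sum (λ b → ind (does (a ≟ x)) * ind (does (b ≟ y))))   ≤⟨ sum-mono (λ a → ≤-trans (≤-reflexive (sym (∑-distrib-+ (ind ∘ P a) _)))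
                                                                                                (sum-mono (disjoint a))) ⟩
      pairs P⁺                                                                 ∎
      where
      row : ∀ a → ind (does (a ≟ x)) ≡ sum (λ b → ind (does (a ≟ x)) * ind (does (b ≟ y)))
      row a = trans (sym (*-identityʳ _)) (trans (cong (ind (does (a ≟ x)) *_) (sym (count-≟ y)))
        (*-distribˡ-sum (ind (does (a ≟ x))) (λ b → ind (does (b ≟ y)))))

  -- Recursion on a bound `k` for the size of `S`, because removing a pair does not make a Boolean
  -- function structurally smaller.
  peel : ∀ k S → count S ≤ k → Copy (Ksub s t) G ⊎ LightMatching S
  peel zero    S S≤0 = inj₂ (no-pairs (≤-trans S≤0 z≤n))
  peel (suc k) S S≤k with count S ≤? s + t
  ... | yes small = inj₂ (no-pairs small)
  -- Representatives of the constant family `S` are `s + t` distinct vertices of `S`.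
  ... | no ¬small with z , Sz , z-inj ← distinct-representatives (s + t) (λ _ → S) (λ _ → ≰⇒> ¬small)
    with light-pair z z-inj
  ...   | inj₁ copy = inj₁ copy
  ...   | inj₂ (a , b , a≢b , ab-light)
    with peel k (S ∖⟨ z a , z b ⟩) (≤-pred (≤-trans (∖-decreases S (Sz a)) S≤k))
  ...     | inj₁ copy = inj₁ copy
  ...     | inj₂ M    = inj₂ (add-pair (Sz a) (Sz b) (a≢b ∘ z-inj) ab-light M)

∀-⊎ : ∀ {n} {A : Set} {B : Fin n → Set} → (∀ i → A ⊎ B i) → A ⊎ (∀ i → B i)
∀-⊎ {zero}  h = inj₂ λ ()
∀-⊎ {suc n} h with h zero | ∀-⊎ (h ∘ suc)
... | inj₁ a  | _       = inj₁ a
... | inj₂ _  | inj₁ a  = inj₁ a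
... | inj₂ b₀ | inj₂ bs = inj₂ λ { zero → b₀ ; (suc i) → bs i }

-- The upper bound

-- A crude Young inequality: the power of the larger base alone bounds the product.
b*q^k≤b^1+k+q^1+k : ∀ b q k → b * q ^ k ≤ b ^ suc k + q ^ suc k
b*q^k≤b^1+k+q^1+k b q k with ≤-total b q
... | inj₁ b≤q = ≤-trans (*-monoˡ-≤ (q ^ k) b≤q) (m≤n+m (q ^ suc k) (b ^ suc k))
... | inj₂ q≤b = ≤-trans (*-monoʳ-≤ b (^-monoˡ-≤ k q≤b)) (m≤m+n (b ^ suc k) (q ^ suc k))

-- Bounding m β(y) (Qν)ᵏ by (m β(y))ᵏ⁺¹ + (Qν)ᵏ⁺¹ and summing replaces the power mean
-- inequality; the factor m avoids dividing Σ β by m.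
power-sum : ∀ {m} (β : Fin m → ℕ) k Q ν → 1 ≤ m → 1 ≤ Q → 2 * Q * ν ≤ sum β → m ^ (1 + 2 * k) ≤ ν ^ suc k →
  Q * m ^ suc k ≤ sum (λ y → β y ^ suc k)
power-sum {m} β k Q ν 1≤m 1≤Q average m≤ν = *-cancelʳ-≤ _ _ (m ^ suc k) {{ℕ.>-nonZero (m^n>0 m {{m≢0}} (suc k))}} (begin
  Q * m ^ suc k * m ^ suc k                      ≡⟨ collect Q m (m ^ k) ⟩
  Q * (m * (m * (m ^ k * m ^ k)))                ≡⟨ cong (λ z → Q * (m * (m * z))) (trans (sym (^-distribˡ-+-* m k k)) (cong (λ z → m ^ (k + z)) (sym (+-identityʳ k)))) ⟩
  Q * (m * m ^ (1 + 2 * k))                      ≤⟨ *-mono-≤ Q≤Q^ (*-monoʳ-≤ m m≤ν) ⟩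
  Q ^ suc k * (m * ν ^ suc k)                    ≡⟨ x∙yz≈y∙xz (Q ^ suc k) m (ν ^ suc k) ⟩
  m * (Q ^ suc k * ν ^ suc k)                    ≡⟨ cong (m *_) (^-distribʳ-* Q ν (suc k)) ⟨
  m * (Q * ν) ^ suc k                            ≤⟨ m*q^s≤ ⟩
  m ^ suc k * sum (λ y → β y ^ suc k)            ≡⟨ *-comm (m ^ suc k) _ ⟩
  sum (λ y → β y ^ suc k) * m ^ suc k            ∎)
  where
  open ≤-Reasoning
  m≢0 : NonZero m
  m≢0 = ℕ.>-nonZero 1≤m
  q = Q * ν
  collect : ∀ Q m z → Q * (m * z) * (m * z) ≡ Q * (m * (m * (z * z)))
  collect = solve-∀
  x∙yz≈y∙xz : ∀ x y z → x * (y * z) ≡ y * (x * z)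
  x∙yz≈y∙xz = solve-∀
  double : ∀ m Q ν z → m * (Q * ν * z) + m * (Q * ν * z) ≡ m * (2 * Q * ν) * z
  double = solve-∀
  Q≤Q^ : Q ≤ Q ^ suc k
  Q≤Q^ = subst (_≤ Q ^ suc k) (*-identityʳ Q) (^-monoʳ-≤ Q {{ℕ.>-nonZero 1≤Q}} {1} {suc k} (s≤s z≤n))
  -- The factor 2 in `average` provides two copies of the left side; one of them cancels the `m`
  -- summands `q ^ suc k`.
  m*q^s≤ : m * q ^ suc k ≤ m ^ suc k * sum (λ y → β y ^ suc k)
  m*q^s≤ = +-cancelʳ-≤ (m * q ^ suc k) _ _ (begin
    m * q ^ suc k + m * q ^ suc k                       ≡⟨ double m Q ν (q ^ k) ⟩
    m * (2 * Q * ν) * q ^ k                             ≤⟨ *-monoˡ-≤ (q ^ k) (*-monoʳ-≤ m average) ⟩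
    m * sum β * q ^ k                                   ≡⟨ cong (_* q ^ k) (*-distribˡ-sum m β) ⟩
    sum (λ y → m * β y) * q ^ k                         ≡⟨ *-distribʳ-sum (q ^ k) (λ y → m * β y) ⟩
    sum (λ y → m * β y * q ^ k)                         ≤⟨ sum-mono (λ y → b*q^k≤b^1+k+q^1+k (m * β y) q k) ⟩
    sum (λ y → (m * β y) ^ suc k + q ^ suc k)           ≡⟨ ∑-distrib-+ (λ y → (m * β y) ^ suc k) (λ _ → q ^ suc k) ⟩
    sum (λ y → (m * β y) ^ suc k) + sum {m} (λ _ → q ^ suc k)
      ≡⟨ cong₂ _+_ (trans (sum-cong-≗ (λ y → ^-distribʳ-* m (β y) (suc k))) (sym (*-distribˡ-sum (m ^ suc k) (λ y → β y ^ suc k)))) (sum-const m (q ^ suc k)) ⟩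
    m ^ suc k * sum (λ y → β y ^ suc k) + m * q ^ suc k ∎)

∑∑-mono : ∀ {a b} {f g : Fin a → Fin b → ℕ} → (∀ i j → f i j ≤ g i j) → sum (λ i → sum (f i)) ≤ sum (λ i → sum (g i))
∑∑-mono f≤g = sum-mono λ i → sum-mono (f≤g i)

module _ (s t : ℕ) {m n : ℕ} (G : BipGraph m n) (M : ∀ w → LightMatching s t G (λ x → G x w)) where

  open module M w = LightMatching (M w)

  matched? : ∀ x y → Dec (∃ λ w → P w x y ≡ true)
  matched? x y = any? (λ w → P w x y Bool.≟ true)

  matched : Fin m → Fin m → Bool
  matched x y = does (matched? x y)

  -- Every `w` whose matching contains the pair is a common neighbour of its ends, and the pair is
  -- light.
  multiplicity : ∀ x y → count (λ w → P w x y) ≤ s * t * ind (matched x y)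
  multiplicity x y with matched? x y
  ... | yes (w , Pxy) = begin
    count (λ w → P w x y)    ≤⟨ count-mono (λ w′ Pxy′ → cong₂ _∧_ (proj₁ (inside w′ Pxy′)) (proj₂ (inside w′ Pxy′))) ⟩
    codegree s t G x y       ≤⟨ light w Pxy ⟩
    s * t                    ≡⟨ *-identityʳ (s * t) ⟨
    s * t * 1                ∎
    where open ≤-Reasoning
  ... | no none = ≤-trans (≤-reflexive (count-none λ w Pxy → none (w , Pxy))) z≤n

  degree : Fin m → ℕ
  degree y = count (λ x → matched x y)

  -- Sum the neighbourhood sizes over `w`: `large` passes to pairs, and grouping these by their ends
  -- costs the multiplicity `s * t`.
  edgeCount≤ : edgeCount G ≤ 2 * (s * t * sum degree) + n * (s + t)
  edgeCount≤ = begin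
    edgeCount G                                                   ≡⟨ edgeCount≡sum G ⟩
    sum (λ x → count (G x))                                       ≡⟨ ∑-comm (λ x w → ind (G x w)) ⟩
    sum (λ w → count (λ x → G x w))                               ≤⟨ sum-mono large ⟩
    sum (λ w → 2 * pairs s t G (P w) + (s + t))                   ≡⟨ ∑-distrib-+ (λ w → 2 * pairs s t G (P w)) (λ _ → s + t) ⟩
    sum (λ w → 2 * pairs s t G (P w)) + sum {n} (λ _ → s + t)     ≡⟨ cong₂ _+_ (sym (*-distribˡ-sum 2 (λ w → pairs s t G (P w)))) (sum-const n (s + t)) ⟩
    2 * sum (λ w → pairs s t G (P w)) + n * (s + t)               ≤⟨ +-monoˡ-≤ (n * (s + t)) (*-monoʳ-≤ 2 pairs≤) ⟩
    2 * (s * t * sum degree) + n * (s + t)                        ∎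
    where
    open ≤-Reasoning
    pairs≤ : sum (λ w → pairs s t G (P w)) ≤ s * t * sum degree
    pairs≤ = begin
      sum (λ w → sum (λ x → sum (λ y → ind (P w x y))))           ≡⟨ ∑-comm (λ w x → count (P w x)) ⟩
      sum (λ x → sum (λ w → sum (λ y → ind (P w x y))))           ≡⟨ sum-cong-≗ (λ x → ∑-comm (λ w y → ind (P w x y))) ⟩
      sum (λ x → sum (λ y → count (λ w → P w x y)))               ≤⟨ ∑∑-mono multiplicity ⟩
      sum (λ x → sum (λ y → s * t * ind (matched x y)))           ≡⟨ ∑-comm (λ x y → s * t * ind (matched x y)) ⟩
      sum (λ y → sum (λ x → s * t * ind (matched x y)))           ≡⟨ sum-cong-≗ (λ y → sym (*-distribˡ-sum (s * t) (λ x → ind (matched x y)))) ⟩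
      sum (λ y → s * t * degree y)                                ≡⟨ *-distribˡ-sum (s * t) degree ⟨
      s * t * sum degree                                          ∎

  -- `label i (c j)` serves as w_ij. The `t` columns are chosen greedily with at most `s * s`
  -- conflicts each, whence the size of `N`. The `x i` and `y (c j)` differ because matched pairs
  -- are irreflexive.
  biclique⇒copy : .{{_ : NonZero s}} → ∀ {N} (x : Fin s → Fin m) (y : Fin N → Fin m) → Injective _≡_ _≡_ x → Injective _≡_ _≡_ y →
    t * (s * s) ℕ.< N → (∀ i j → matched (x i) (y j) ≡ true) → Copy (Ksub s t) G
  biclique⇒copy {N} x y x-inj y-inj N-large adj
    = let c , _ , free = greedy t (λ _ _ → true) conflict conflict-bound
            (λ _ → subst (t * (s * s) ℕ.<_) (sym (trans (sum-const N 1) (*-identityʳ N))) N-large)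
          g-inj : Injective _≡_ _≡_ (λ ((i , j) : Fin s × Fin t) → label i (c j))
          g-inj {i , j} {i′ , j′} eq = label-injective c free i j i′ j′ eq
      in record
      { f     = [ x , y ∘ c ]′
      ; g     = λ (i , j) → label i (c j)
      ; f-inj = λ { {inj₁ i} {inj₁ i′} eq → cong inj₁ (x-inj eq)
                  ; {inj₁ i} {inj₂ j}  eq → ⊥-elim (irreflexive _ (label-P i (c j)) eq)
                  ; {inj₂ j} {inj₁ i}  eq → ⊥-elim (irreflexive _ (label-P i (c j)) (sym eq))
                  -- Equal columns carry equal labels in row `first`, which exists since `s` is
                  -- positive; injectivity of `c` thus follows from that of the labels.
                  ; {inj₂ j} {inj₂ j′} eq → cong inj₂ (cong proj₂ (g-inj {first , j} {first , j′} (cong (label first) (y-inj eq)))) }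
      ; g-inj = λ {w} {w′} → g-inj {w} {w′}
      ; edges = λ { (inj₁ i) (.i , j) refl → proj₁ (inside _ (label-P i (c j)))
                  ; (inj₂ j) (i , .j) refl → proj₂ (inside _ (label-P i (c j))) }
      }
    where
    first : Fin s
    first = Fin.fromℕ< (ℕ.>-nonZero⁻¹ s)

    label : Fin s → Fin N → Fin n
    label i j = proj₁ (witness (matched? (x i) (y j)) (adj i j))

    label-P : ∀ i j → P (label i j) (x i) (y j) ≡ true
    label-P i j = proj₂ (witness (matched? (x i) (y j)) (adj i j))

    conflict? : ∀ j j′ → Dec (∃ λ i → ∃ λ i′ → label i′ j′ ≡ label i j)
    conflict? j j′ = any? (λ i → any? (λ i′ → label i′ j′ ≟ label i j))

    conflict : Fin N → Fin N → Bool
    conflict j j′ = does (conflict? j j′)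

    same : Fin N → Fin s → Fin s → Fin N → ℕ
    same j i i′ j′ = ind (does (label i′ j′ ≟ label i j))

    conflict≤ : ∀ j j′ → ind (conflict j j′) ≤ sum (λ i → sum (λ i′ → same j i i′ j′))
    conflict≤ j j′ with conflict? j j′
    ... | no _ = z≤n
    ... | yes (i , i′ , eq) = begin
      1                                         ≡⟨ cong ind (dec-true (label i′ j′ ≟ label i j) eq) ⟨
      same j i i′ j′                            ≤⟨ term≤sum (λ i′ → same j i i′ j′) i′ ⟩
      sum (λ i′ → same j i i′ j′)               ≤⟨ term≤sum (λ i → sum (λ i′ → same j i i′ j′)) i ⟩
      sum (λ i → sum (λ i′ → same j i i′ j′))   ∎
      where open ≤-Reasoning

    -- Once w is fixed, x i′ determines its partner in the matching of w.
    same-unique : ∀ j i i′ → sum (same j i i′) ≤ 1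
    same-unique j i i′ = count-unique λ j₁ j₂ eq₁ eq₂ → y-inj (right-unique (label i j) (at j₁ eq₁) (at j₂ eq₂))
      where
      at : ∀ j′ → does (label i′ j′ ≟ label i j) ≡ true → P (label i j) (x i′) (y j′) ≡ true
      at j′ eq = subst (λ w → P w (x i′) (y j′) ≡ true) (witness (label i′ j′ ≟ label i j) eq) (label-P i′ j′)

    -- A union bound over the pairs (`i`, `i′`), each of which excludes at most one column.
    conflict-bound : ∀ j → count (conflict j) ≤ s * s
    conflict-bound j = begin
      count (conflict j)                                        ≤⟨ sum-mono (conflict≤ j) ⟩
      sum (λ j′ → sum (λ i → sum (λ i′ → same j i i′ j′)))      ≡⟨ ∑-comm (λ j′ i → sum (λ i′ → same j i i′ j′)) ⟩
      sum (λ i → sum (λ j′ → sum (λ i′ → same j i i′ j′)))      ≡⟨ sum-cong-≗ (λ i → ∑-comm (λ j′ i′ → same j i i′ j′)) ⟩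
      sum (λ i → sum (λ i′ → sum (same j i i′)))                ≤⟨ ∑∑-mono (same-unique j) ⟩
      sum {s} (λ _ → sum {s} (λ _ → 1))                         ≡⟨ sum-const s _ ⟩
      s * sum {s} (λ _ → 1)                                     ≡⟨ cong (s *_) (trans (sum-const s 1) (*-identityʳ s)) ⟩
      s * s                                                     ∎
      where open ≤-Reasoning

    -- Within one column, both left ends are matched to the same vertex by the same `w`, so they
    -- coincide. For two columns, the greedy choice forbids the earlier one to share a label with
    -- the later one.
    label-injective : (c : Fin t → Fin N) → (∀ j j′ → j Fin.< j′ → conflict (c j) (c j′) ≡ false) →
      ∀ i j i′ j′ → label i (c j) ≡ label i′ (c j′) → (i , j) ≡ (i′ , j′)
    label-injective c free i j i′ j′ eq with Fin.<-cmp j j′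
    ... | tri≈ _ refl _ = cong (_, j) (x-inj (left-unique (label i′ (c j)) (subst (λ w → P w (x i) (y (c j)) ≡ true) eq (label-P i (c j))) (label-P i′ (c j))))
    ... | tri< j<j′ _ _ with () ← trans (sym (dec-true (conflict? (c j) (c j′)) (i , i′ , sym eq))) (free j j′ j<j′)
    ... | tri> _ _ j′<j with () ← trans (sym (dec-true (conflict? (c j′) (c j)) (i′ , i , eq))) (free j′ j j′<j)

-- The constant before `n` collects the losses: `s + t` uncovered vertices per neighbourhood, two
-- ends per pair, `s * t` repetitions of a pair, and then `s + 2 * T` multiples of `ν`, of which `s`
-- pay for passing from `deg` to `β` and `2 * T` feed `power-sum`.
many-edges⇒copy : ∀ k t E {m n} (G : BipGraph m n) → 1 ≤ t → 1 ≤ m → m ^ (1 + 2 * k) ≤ (E * n) ^ suc k →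
  (suc k + t + 2 * (suc k * t * (suc k + 2 * (2 + t * (suc k * suc k))) * E)) * n ≤ edgeCount G → Copy (Ksub (suc k) t) G
many-edges⇒copy k t E {m} {n} G 1≤t 1≤m m≤ν dense
  = [ (λ copy → copy) , from-matchings ]′ (∀-⊎ (λ w → peel s t G _ (λ x → G x w) ≤-refl))
  where
  s = suc k
  ℓ = s * t
  -- More than `t * (s * s)` columns are needed, and `distinct-representatives` asks for one element
  -- to spare.
  T = 2 + t * (s * s)
  ν = E * n
  -- Bounds the total degree loss `s * m` by `s * ν`; it holds because 2k + 1 is at least k + 1.
  m≤E*n : m ≤ ν
  m≤E*n = ^-cancelˡ-≤ s (begin
    m ^ suc k                 ≤⟨ ^-monoʳ-≤ m {{ℕ.>-nonZero 1≤m}} (s≤s (m≤m+n k (k + 0))) ⟩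
    m ^ (1 + 2 * k)           ≤⟨ m≤ν ⟩
    ν ^ suc k                 ∎)
    where open ≤-Reasoning

  from-matchings : (∀ w → LightMatching s t G (λ x → G x w)) → Copy (Ksub s t) G
  from-matchings M =
    let x , Y′ , x-inj , Y′-large , Y′-adj = kővári–sós–turán s T A Y β 1≤m (s≤s z≤n) Y-degree large
        y , Y′y , y-inj = distinct-representatives (1 + t * (s * s)) (λ _ → Y′) (λ _ → Y′-large)
    in biclique⇒copy s t G M x y x-inj y-inj ≤-refl (λ i j → proj₂ (Y′-adj (y j) (Y′y j)) i)
    where
    open ≤-Reasoning
    A : Fin m → Fin m → Bool
    A = matched s t G M
    deg β : Fin m → ℕ
    deg = degree s t G M
    -- Subtracting `s` leaves the surplus that `kővári–sós–turán` demands of the degrees.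
    β y = deg y ∸ s
    Y : Fin m → Bool
    Y y = does (s ≤? deg y)

    Y-degree : ∀ y → Y y ≡ true → β y + s ≤ deg y
    Y-degree y Yy = ≤-reflexive (m∸n+n≡m (witness (s ≤? deg y) Yy))

    rearrange : ∀ a b ℓ c E n → (a + b + 2 * (ℓ * c * E)) * n ≡ 2 * (ℓ * (c * (E * n))) + n * (a + b)
    rearrange = solve-∀

    degree-sum : (s + 2 * T) * ν ≤ sum deg
    degree-sum = *-cancelˡ-≤ ℓ {{ℕ.>-nonZero (*-mono-≤ {1} {s} (s≤s z≤n) 1≤t)}} (*-cancelˡ-≤ 2 (+-cancelʳ-≤ (n * (s + t)) _ _ (begin
      2 * (ℓ * ((s + 2 * T) * ν)) + n * (s + t)        ≡⟨ rearrange s t ℓ (s + 2 * T) E n ⟨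
      (s + t + 2 * (ℓ * (s + 2 * T) * E)) * n          ≤⟨ dense ⟩
      edgeCount G                                      ≤⟨ edgeCount≤ s t G M ⟩
      2 * (ℓ * sum deg) + n * (s + t)                  ∎)))

    β-sum : 2 * T * ν ≤ sum β
    β-sum = +-cancelˡ-≤ (s * ν) _ _ (begin
      s * ν + 2 * T * ν                  ≡⟨ *-distribʳ-+ ν s (2 * T) ⟨
      (s + 2 * T) * ν                    ≤⟨ degree-sum ⟩
      sum deg                            ≤⟨ sum-mono (λ y → m≤n+m∸n (deg y) s) ⟩
      sum (λ y → s + β y)                ≡⟨ ∑-distrib-+ (λ _ → s) β ⟩
      sum {m} (λ _ → s) + sum β          ≡⟨ cong (_+ sum β) (trans (sum-const m s) (*-comm m s)) ⟩
      s * m + sum β                      ≤⟨ +-monoˡ-≤ (sum β) (*-monoʳ-≤ s m≤E*n) ⟩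
      s * ν + sum β                      ∎)

    -- Below degree `s` the truncated `β y` is 0, and `0 ^ s` is 0 as `s` is positive; restricting
    -- the sum to `Y` loses nothing.
    outside-Y : ∀ y (s≤deg? : Dec (s ≤ deg y)) → β y ^ s ≤ ind (does s≤deg?) * β y ^ s
    outside-Y y (yes _)     = ≤-reflexive (sym (*-identityˡ (β y ^ s)))
    outside-Y y (no s≰deg)  = ≤-reflexive (cong (_^ s) (m≤n⇒m∸n≡0 (<⇒≤ (≰⇒> s≰deg))))

    large : T * m ^ s ≤ sum (λ y → ind (Y y) * β y ^ s)
    large = ≤-trans (power-sum β k T ν 1≤m (s≤s z≤n) β-sum m≤ν) (sum-mono λ y → outside-Y y (s ≤? deg y))

sigma-upper : ∀ s t → .{{_ : NonZero s}} → 1 ≤ t → LinThresholdAtMost (Ksub s t) (sigma s)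
sigma-upper (suc k) t 1≤t ε 0<ε = ℕtoℚ δ , λ m n G 1≤m many dense →
  many-edges⇒copy k t (↧ₙ ε) G 1≤t 1≤m (AtLeastPow-sigma k n ε m 0<ε many)
    (ℕtoℚ-cancel-≤ (subst (ℚ._≤ ℕtoℚ (edgeCount G)) (sym (ℕtoℚ-* δ n)) dense))
  where
  δ = suc k + t + 2 * (suc k * t * (suc k + 2 * (2 + t * (suc k * suc k))) * ↧ₙ ε)

-- The lower bound

funToFin-cong : ∀ {N M} {f g : Fin N → Fin M} → f ≗ g → funToFin f ≡ funToFin g
funToFin-cong {zero}  f≗g = refl
funToFin-cong {suc N} f≗g = cong₂ combine (f≗g zero) (funToFin-cong (f≗g ∘ suc))

funToFin-injective : ∀ {N M} {f g : Fin N → Fin M} → funToFin f ≡ funToFin g → f ≗ g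
funToFin-injective {f = f} {g} eq i =
  trans (sym (Fin.finToFun-funToFin f i)) (trans (cong (λ k → finToFun k i) eq) (Fin.finToFun-funToFin g i))

finToFun-injective : ∀ {N M} (ω ω′ : Fin (M ^ N)) → finToFun {M} {N} ω ≗ finToFun ω′ → ω ≡ ω′
finToFun-injective {N} {M} ω ω′ eq =
  trans (sym (Fin.funToFin-finToFin {N} {M} ω)) (trans (funToFin-cong eq) (Fin.funToFin-finToFin {N} {M} ω′))

remQuot-injective : ∀ {a} b {i j : Fin (a * b)} → remQuot {a} b i ≡ remQuot b j → i ≡ j
remQuot-injective {a} b {i} {j} eq =
  trans (sym (Fin.combine-remQuot {a} b i)) (trans (cong (λ (x , y) → combine x y) eq) (Fin.combine-remQuot {a} b j))

-- Overwriting letters and compression of words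

module _ {N r : ℕ} {A : Set} (pos : Fin r → Fin N) (z : Fin r → A) (v : Fin N → A) where

  overwrite : Fin N → A
  overwrite p with any? (λ c → pos c ≟ p)
  ... | yes (c , _) = z c
  ... | no _        = v p

  overwrite-on : Injective _≡_ _≡_ pos → ∀ c → overwrite (pos c) ≡ z c
  overwrite-on pos-inj c with any? (λ c′ → pos c′ ≟ pos c)
  ... | yes (c′ , eq) = cong z (pos-inj eq)
  ... | no none       = ⊥-elim (none (c , refl))

  overwrite-off : ∀ {p} → ¬ (∃ λ c → pos c ≡ p) → overwrite p ≡ v p
  overwrite-off {p} off with any? (λ c → pos c ≟ p)
  ... | yes on = ⊥-elim (off on)
  ... | no _   = refl

-- A word ω together with r fresh letters ζ is recovered from the code of ω and the word
-- obtained by overwriting the positions prescribed by that code with ζ.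
compression : ∀ {M N r K} .{{_ : NonZero M}}
  (code : Fin (M ^ N) → Fin K) (pos : Fin (M ^ N) → Fin r → Fin N) (val : Fin (M ^ N) → Fin r → Fin M) →
  (∀ ω → Injective _≡_ _≡_ (pos ω)) →
  (∀ ω c → finToFun ω (pos ω c) ≡ val ω c) →
  (∀ ω ω′ → code ω ≡ code ω′ → ∀ c → pos ω c ≡ pos ω′ c × val ω c ≡ val ω′ c) →
  M ^ r ≤ K
compression {M} {N} {r} {K} code pos val pos-inj prescribed determined =
  *-cancelˡ-≤ (M ^ N) {{m^n≢0 M N}} (subst (M ^ N * M ^ r ≤_) (*-comm K (M ^ N)) (Fin.injective⇒≤ encode-injective))
  where
  word : Fin (M ^ N) → Fin (M ^ r) → Fin N → Fin M
  word ω ζ = overwrite (pos ω) (finToFun ζ) (finToFun ω)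

  encode₂ : Fin (M ^ N) → Fin (M ^ r) → Fin (K * M ^ N)
  encode₂ ω ζ = combine (code ω) (funToFin (word ω ζ))

  encode₂-injective : ∀ ω ζ ω′ ζ′ → encode₂ ω ζ ≡ encode₂ ω′ ζ′ → (ω , ζ) ≡ (ω′ , ζ′)
  encode₂-injective ω ζ ω′ ζ′ eq = cong₂ _,_ (finToFun-injective ω ω′ words) (finToFun-injective ζ ζ′ letters)
    where
    open ≡-Reasoning
    same = determined ω ω′ (proj₁ (Fin.combine-injective (code ω) _ (code ω′) _ eq))
    overwritten : word ω ζ ≗ word ω′ ζ′
    overwritten = funToFin-injective (proj₂ (Fin.combine-injective (code ω) _ (code ω′) _ eq))

    letters : finToFun ζ ≗ finToFun ζ′
    letters c = begin
      finToFun ζ c             ≡⟨ overwrite-on (pos ω) _ _ (pos-inj ω) c ⟨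
      word ω ζ (pos ω c)       ≡⟨ overwritten (pos ω c) ⟩
      word ω′ ζ′ (pos ω c)     ≡⟨ cong (word ω′ ζ′) (proj₁ (same c)) ⟩
      word ω′ ζ′ (pos ω′ c)    ≡⟨ overwrite-on (pos ω′) _ _ (pos-inj ω′) c ⟩
      finToFun ζ′ c            ∎

    words : finToFun ω ≗ finToFun ω′
    -- At a prescribed position the code determines the letter; anywhere else overwriting has left
    -- the word unchanged.
    words p with any? (λ c → pos ω c ≟ p)
    ... | yes (c , refl) = begin
      finToFun ω (pos ω c)     ≡⟨ prescribed ω c ⟩
      val ω c                  ≡⟨ proj₂ (same c) ⟩
      val ω′ c                 ≡⟨ prescribed ω′ c ⟨
      finToFun ω′ (pos ω′ c)   ≡⟨ cong (finToFun ω′) (proj₁ (same c)) ⟨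
      finToFun ω′ (pos ω c)    ∎
    ... | no off = begin
      finToFun ω p             ≡⟨ overwrite-off (pos ω) _ _ off ⟨
      word ω ζ p               ≡⟨ overwritten p ⟩
      word ω′ ζ′ p             ≡⟨ overwrite-off (pos ω′) _ _ (λ (c , eq) → off (c , trans (proj₁ (same c)) eq)) ⟩
      finToFun ω′ p            ∎

  encode : Fin (M ^ N * M ^ r) → Fin (K * M ^ N)
  encode e = encode₂ (proj₁ (remQuot (M ^ r) e)) (proj₂ (remQuot {M ^ N} (M ^ r) e))

  encode-injective : Injective _≡_ _≡_ encode
  encode-injective eq = remQuot-injective {M ^ N} (M ^ r) (encode₂-injective _ _ _ _ eq)

-- Sums over classes and transversal graphs

sum-++ : ∀ a {b} (f : Fin (a + b) → ℕ) → sum f ≡ sum (λ i → f (i Fin.↑ˡ b)) + sum (λ j → f (a Fin.↑ʳ j))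
sum-++ zero    f = refl
sum-++ (suc a) f = trans (cong (λ z → f zero + z) (sum-++ a (f ∘ suc))) (sym (+-assoc (f zero) _ _))

sum-combine : ∀ a {b} (f : Fin (a * b) → ℕ) → sum f ≡ sum (λ (i : Fin a) → sum (λ (j : Fin b) → f (combine i j)))
sum-combine zero        f = refl
sum-combine (suc a) {b} f = trans (sum-++ b f) (cong (λ z → sum (λ j → f (j Fin.↑ˡ (a * b))) + z) (sum-combine a (λ i → f (b Fin.↑ʳ i))))

-- The left side consists of d classes of size M, and the right vertex w is joined to exactly
-- one vertex of each class k, the one written at position (w , k) of the word ω.
module Transversal (d M n : ℕ) where

  class : Fin (d * M) → Fin d
  class u = proj₁ (remQuot {d} M u)

  value : Fin (d * M) → Fin M
  value u = proj₂ (remQuot {d} M u)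

  class-value-injective : ∀ {u u′} → class u ≡ class u′ → value u ≡ value u′ → u ≡ u′
  class-value-injective eq₁ eq₂ = remQuot-injective {d} M (cong₂ _,_ eq₁ eq₂)

  graph : Fin (M ^ (n * d)) → BipGraph (d * M) n
  graph ω u w = does (value u ≟ finToFun ω (combine w (class u)))

  edgeCount-graph : ∀ ω → edgeCount (graph ω) ≡ n * d
  edgeCount-graph ω = begin
    edgeCount (graph ω)                          ≡⟨ edgeCount≡sum (graph ω) ⟩
    sum (λ u → count (graph ω u))                ≡⟨ ∑-comm (λ u w → ind (graph ω u w)) ⟩
    sum (λ w → sum (λ u → ind (graph ω u w)))    ≡⟨ sum-cong-≗ right-degree ⟩
    sum {n} (λ _ → d)                            ≡⟨ sum-const n d ⟩
    n * d                                        ∎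
    where
    open ≡-Reasoning
    class-degree : ∀ w (k : Fin d) → sum (λ (x : Fin M) → ind (graph ω (combine k x) w)) ≡ 1
    class-degree w k = trans
      (sum-cong-≗ λ x → cong (λ (k , x) → ind (does (x ≟ finToFun ω (combine w k)))) (Fin.remQuot-combine k x))
      (count-≟ (finToFun ω (combine w k)))
    right-degree : ∀ w → sum (λ u → ind (graph ω u w)) ≡ d
    right-degree w = begin
      sum (λ u → ind (graph ω u w))                          ≡⟨ sum-combine d (λ u → ind (graph ω u w)) ⟩
      sum (λ (k : Fin d) → sum (λ (x : Fin M) → ind (graph ω (combine k x) w)))  ≡⟨ sum-cong-≗ (class-degree w) ⟩
      sum {d} (λ _ → 1)                                      ≡⟨ trans (sum-const d 1) (*-identityʳ d) ⟩
      d                                                      ∎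

-- Counting copies in transversal graphs

module Incidence (s t : ℕ) where
  open Pattern (Ksub s t)

  -- The 2st edges of K'_{s,t}: `inj₁` lists the edges u_i w_ij and `inj₂` the edges v_j w_ij, with
  -- (i, j) decoded from `e`.
  incidence : Fin (s * t) ⊎ Fin (s * t) → A × B
  incidence (inj₁ e) = inj₁ (proj₁ (remQuot {s} t e)) , remQuot t e
  incidence (inj₂ e) = inj₂ (proj₂ (remQuot {s} t e)) , remQuot t e

  incident : ∀ c → E (proj₁ (incidence c)) (proj₂ (incidence c))
  incident (inj₁ e) = refl
  incident (inj₂ e) = refl

  incidence-injective : ∀ c c′ → incidence c ≡ incidence c′ → c ≡ c′
  incidence-injective (inj₁ e) (inj₁ e′) eq = cong inj₁ (remQuot-injective {s} t (cong proj₂ eq))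
  incidence-injective (inj₂ e) (inj₂ e′) eq = cong inj₂ (remQuot-injective {s} t (cong proj₂ eq))
  incidence-injective (inj₁ e) (inj₂ e′) eq with () ← cong proj₁ eq
  incidence-injective (inj₂ e) (inj₁ e′) eq with () ← cong proj₁ eq

module _ (s t d M n : ℕ) .{{_ : NonZero M}} where
  open Transversal d M n
  open Incidence s t

  -- The code of a word lists the images of all vertices under the copy in its graph. Each of the
  -- 2st edges then fixes one letter, at the position given by its right image and the class of its
  -- left image.
  copies⇒many : (∀ ω → Copy (Ksub s t) (graph ω)) → M ^ (s * t + s * t) ≤ (d * M) ^ (s + t) * n ^ (s * t)
  copies⇒many copy = compression code pos val pos-injective prescribed determined
    where
    open module C ω = Copy (copy ω)

    Left  = λ c → proj₁ (incidence (splitAt (s * t) c))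
    Right = λ c → proj₂ (incidence (splitAt (s * t) c))

    code : Fin (M ^ (n * d)) → Fin ((d * M) ^ (s + t) * n ^ (s * t))
    code ω = combine (funToFin (f ω ∘ splitAt s)) (funToFin (g ω ∘ remQuot {s} t))

    pos : Fin (M ^ (n * d)) → Fin (s * t + s * t) → Fin (n * d)
    pos ω c = combine (g ω (Right c)) (class (f ω (Left c)))

    val : Fin (M ^ (n * d)) → Fin (s * t + s * t) → Fin M
    val ω c = value (f ω (Left c))

    prescribed : ∀ ω c → finToFun ω (pos ω c) ≡ val ω c
    prescribed ω c = sym (witness (_ ≟ _) (edges ω (Left c) (Right c) (incident (splitAt (s * t) c))))

    -- A position carries a single letter. Two edges with the same position therefore have left
    -- images of equal class and equal value, and injectivity of the copy identifies the edges.
    pos-injective : ∀ ω → Injective _≡_ _≡_ (pos ω)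
    pos-injective ω {c} {c′} eq =
      splitAt-injective (incidence-injective _ _ (cong₂ _,_ same-left (g-inj ω (proj₁ same))))
      where
      same : g ω (Right c) ≡ g ω (Right c′) × class (f ω (Left c)) ≡ class (f ω (Left c′))
      same = Fin.combine-injective _ _ _ _ eq
      same-left : Left c ≡ Left c′
      same-left = f-inj ω (class-value-injective (proj₂ same)
        (trans (sym (prescribed ω c)) (trans (cong (finToFun ω) eq) (prescribed ω c′))))
      splitAt-injective : splitAt (s * t) c ≡ splitAt (s * t) c′ → c ≡ c′
      splitAt-injective h = trans (sym (Fin.join-splitAt (s * t) (s * t) c))
        (trans (cong (Fin.join (s * t) (s * t)) h) (Fin.join-splitAt (s * t) (s * t) c′))

    determined : ∀ ω ω′ → code ω ≡ code ω′ → ∀ c → pos ω c ≡ pos ω′ c × val ω c ≡ val ω′ c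
    determined ω ω′ eq c = cong₂ combine (same-g (Right c)) (cong class (same-f (Left c))) , cong value (same-f (Left c))
      where
      same-f : f ω ≗ f ω′
      same-f a = subst (λ a → f ω a ≡ f ω′ a) (Fin.splitAt-join s t a)
        (funToFin-injective (proj₁ (Fin.combine-injective _ _ _ _ eq)) (Fin.join s t a))
      same-g : g ω ≗ g ω′
      same-g (i , j) = subst (λ b → g ω b ≡ g ω′ b) (Fin.remQuot-combine i j)
        (funToFin-injective (proj₂ (Fin.combine-injective (funToFin (f ω ∘ splitAt s)) _ _ _ eq)) (combine i j))

-- Exponents and choice of parameters

few-codes : ∀ k t p q d x → p * suc k ℕ.< (1 + 2 * k) * q → q * suc k ℕ.< t → d ^ (suc k + t + p * (suc k * t)) ℕ.< x →
  (d * x ^ q) ^ (suc k + t) * ((d * x) ^ p) ^ (suc k * t) ℕ.< (x ^ q) ^ (suc k * t + suc k * t)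
few-codes k t p q d x ps<rq qs<t d<x = begin-strict
  (d * x ^ q) ^ (s + t) * ((d * x) ^ p) ^ (s * t)
    ≡⟨ cong₂ _*_ (^-distribʳ-* d (x ^ q) (s + t)) (trans (^-*-assoc (d * x) p (s * t)) (^-distribʳ-* d x (p * (s * t)))) ⟩
  (d ^ (s + t) * (x ^ q) ^ (s + t)) * (d ^ (p * (s * t)) * x ^ (p * (s * t)))
    ≡⟨ interchange (d ^ (s + t)) ((x ^ q) ^ (s + t)) (d ^ (p * (s * t))) (x ^ (p * (s * t))) ⟩
  (d ^ (s + t) * d ^ (p * (s * t))) * ((x ^ q) ^ (s + t) * x ^ (p * (s * t)))
    ≡⟨ cong₂ _*_ (sym (^-distribˡ-+-* d (s + t) (p * (s * t)))) (trans (cong (_* x ^ (p * (s * t))) (^-*-assoc x q (s + t)))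
         (sym (^-distribˡ-+-* x (q * (s + t)) (p * (s * t))))) ⟩
  d ^ (s + t + p * (s * t)) * x ^ (q * (s + t) + p * (s * t))
    <⟨ *-monoˡ-< (x ^ (q * (s + t) + p * (s * t))) {{m^n≢0 x (q * (s + t) + p * (s * t)) {{x≢0}}}} d<x ⟩
  x ^ suc (q * (s + t) + p * (s * t))
    ≤⟨ ^-monoʳ-≤ x {{x≢0}} exponents ⟩
  x ^ (q * (s * t + s * t))
    ≡⟨ ^-*-assoc x q (s * t + s * t) ⟨
  (x ^ q) ^ (s * t + s * t) ∎
  where
  open ≤-Reasoning
  s = suc k
  x≢0 : NonZero x
  x≢0 = ℕ.>-nonZero (≤-<-trans z≤n d<x)
  interchange : ∀ a b c e → (a * b) * (c * e) ≡ (a * c) * (b * e)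
  interchange = solve-∀
  lhs : ∀ q s t p → suc (q * (s + t) + p * (s * t)) ≡ p * s * t + suc (q * s) + q * t
  lhs = solve-∀
  mid : ∀ p s t q → p * s * t + t + q * t ≡ suc (p * s) * t + q * t
  mid = solve-∀
  rhs : ∀ k q t → (1 + 2 * k) * q * t + q * t ≡ q * (suc k * t + suc k * t)
  rhs = solve-∀
  -- `qs<t` absorbs `suc (q * s)` into `t`; the gap in `ps<rq`, multiplied by `t`, absorbs that `t`.
  -- The spare factor `x` on the left dominates all powers of `d`.
  exponents : suc (q * (s + t) + p * (s * t)) ≤ q * (s * t + s * t)
  exponents = begin
    suc (q * (s + t) + p * (s * t))          ≡⟨ lhs q s t p ⟩
    p * s * t + suc (q * s) + q * t          ≤⟨ +-monoˡ-≤ (q * t) (+-monoʳ-≤ (p * s * t) qs<t) ⟩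
    p * s * t + t + q * t                    ≡⟨ mid p s t q ⟩
    suc (p * s) * t + q * t                  ≤⟨ +-monoˡ-≤ (q * t) (*-monoˡ-≤ t ps<rq) ⟩
    (1 + 2 * k) * q * t + q * t              ≡⟨ rhs k q t ⟩
    q * (s * t + s * t)                      ∎

1^ℚ : ∀ q → 1ℚ ^ℚ q ≡ 1ℚ
1^ℚ zero    = refl
1^ℚ (suc q) = trans (ℚ.*-identityˡ (1ℚ ^ℚ q)) (1^ℚ q)

-- A negative exponent σ is handled through p = 0.
nonneg-exponent : ∀ k σ → σ ℚ.< sigma (suc k) → Σ ℕ λ p → p * suc k ℕ.< (1 + 2 * k) * ↧ₙ σ ×
  (∀ n m → 1 ≤ m → m ^ p ≤ n ^ ↧ₙ σ → AtLeastPow n 1ℚ m σ)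
nonneg-exponent k σ@(mkℚ (+ p) _ _) σ< with sigma-fraction k
... | k′ , num , frac = p , ps< , λ n m _ mᵖ≤nᵠ → begin
    (1ℚ ^ℚ q) ℚ.* (ℕtoℚ m ^ℚ p)    ≡⟨ trans (cong₂ ℚ._*_ (1^ℚ q) (sym (ℕtoℚ-^ m p))) (ℚ.*-identityˡ _) ⟩
    ℕtoℚ (m ^ p)                   ≤⟨ ℕtoℚ-mono-≤ mᵖ≤nᵠ ⟩
    ℕtoℚ (n ^ q)                   ≡⟨ ℕtoℚ-^ n q ⟩
    ℕtoℚ n ^ℚ q                    ∎
  where
  open ℚ.≤-Reasoning
  q = ↧ₙ σ
  q′ = ↧ₙ sigma (suc k)
  pq′<k′q : p * q′ ℕ.< k′ * q
  pq′<k′q = ℤ.drop‿+<+ (subst₂ ℤ._<_ (sym (ℤ.pos-* p q′)) (trans (cong (ℤ._* + q) num) (sym (ℤ.pos-* k′ q))) (ℚ.drop-*<* σ<))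
  ps< : p * suc k ℕ.< (1 + 2 * k) * q
  ps< = *-cancelʳ-< q′ _ _ (subst₂ ℕ._<_ (xy∙z≈xz∙y p q′ (suc k))
    (trans (xy∙z≈xz∙y k′ q (suc k)) (trans (cong (_* q) frac) (xy∙z≈xz∙y (1 + 2 * k) q′ q)))
    (*-monoˡ-< (suc k) pq′<k′q))
    where
    xy∙z≈xz∙y : ∀ x y z → x * y * z ≡ x * z * y
    xy∙z≈xz∙y = solve-∀
nonneg-exponent k σ@(mkℚ -[1+ j ] _ _) σ< = 0 , s≤s z≤n , λ n m 1≤m 1≤nᵠ → begin
    1ℚ ^ℚ q                                  ≡⟨ 1^ℚ q ⟩
    1ℚ                                       ≤⟨ ℕtoℚ-mono-≤ (*-mono-≤ 1≤nᵠ (m^n>0 m {{ℕ.>-nonZero 1≤m}} (suc j))) ⟩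
    ℕtoℚ (n ^ q * m ^ suc j)                 ≡⟨ trans (ℕtoℚ-* (n ^ q) (m ^ suc j)) (cong₂ ℚ._*_ (ℕtoℚ-^ n q) (ℕtoℚ-^ m (suc j))) ⟩
    (ℕtoℚ n ^ℚ q) ℚ.* (ℕtoℚ m ^ℚ suc j)      ∎
  where
  open ℚ.≤-Reasoning
  q = ↧ₙ σ

sigma-lower : ∀ s → .{{_ : NonZero s}} → ∀ σ → σ ℚ.< sigma s →
  Σ ℕ λ t₀ → ∀ t → t ≥ t₀ → LinThresholdGreater (Ksub s t) σ
sigma-lower (suc k) σ σ< with p , ps< , atLeast ← nonneg-exponent k σ σ<
  -- This `t₀` ensures `q * s < t`, and already `ε = 1` admits no `δ`.
  = suc (↧ₙ σ * suc k) , λ t t≥t₀ holds → no-threshold p ps< atLeast t t≥t₀ (holds 1ℚ (ℚ.*<* (ℤ.+<+ (s≤s z≤n))))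
  where
  s = suc k
  q = ↧ₙ σ
  no-threshold : ∀ p → p * s ℕ.< (1 + 2 * k) * q → (∀ n m → 1 ≤ m → m ^ p ≤ n ^ q → AtLeastPow n 1ℚ m σ) →
    ∀ t → q * s ℕ.< t →
    ¬ (Σ ℚ λ δ → (m n : ℕ) (G : BipGraph m n) → 1 ≤ m → AtLeastPow n 1ℚ m σ →
        δ ℚ.* ℕtoℚ n ℚ.≤ ℕtoℚ (edgeCount G) → Copy (Ksub s t) G)
  no-threshold p ps< atLeast t qs<t (δ , holds) =
    <⇒≱ (few-codes k t p q d x ps< qs<t ≤-refl) (copies⇒many s t d M n {{M≢0}} λ ω →
      holds (d * M) n (graph ω) (*-mono-≤ {1} {d} (s≤s z≤n) (ℕ.>-nonZero⁻¹ M {{M≢0}}))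
        (atLeast n (d * M) (*-mono-≤ {1} {d} (s≤s z≤n) (ℕ.>-nonZero⁻¹ M {{M≢0}})) big) (dense ω))
    where
    -- A positive integer above `δ`, whatever the sign of `δ`; `d` classes give `n * d` edges.
    d = suc ∣ ↥ δ ∣
    x = suc (d ^ (s + t + p * (s * t)))
    -- Exact powers avoid roots: with `d * M` left vertices, `(d * M) ^ p` is at most
    -- `(d * x) ^ (p * q)`, which is `n ^ q`, because `d` is at most `d ^ q`.
    M = x ^ q
    n = (d * x) ^ p
    open Transversal d M n
    M≢0 : NonZero M
    M≢0 = m^n≢0 x q

    big : (d * M) ^ p ≤ n ^ q
    big = begin
      (d * x ^ q) ^ p          ≤⟨ ^-monoˡ-≤ p (*-monoˡ-≤ (x ^ q) (subst (_≤ d ^ q) (*-identityʳ d) (^-monoʳ-≤ d {1} {q} (s≤s z≤n)))) ⟩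
      (d ^ q * x ^ q) ^ p      ≡⟨ cong (_^ p) (^-distribʳ-* d x q) ⟨
      ((d * x) ^ q) ^ p        ≡⟨ ^-*-assoc (d * x) q p ⟩
      (d * x) ^ (q * p)        ≡⟨ cong ((d * x) ^_) (*-comm q p) ⟩
      (d * x) ^ (p * q)        ≡⟨ ^-*-assoc (d * x) p q ⟨
      n ^ q                    ∎
      where open ≤-Reasoning

    dense : ∀ ω → δ ℚ.* ℕtoℚ n ℚ.≤ ℕtoℚ (edgeCount (graph ω))
    dense ω = begin
      δ ℚ.* ℕtoℚ n
        ≤⟨ ℚ.*-monoʳ-≤-nonNeg (ℕtoℚ n) {{ℚ.nonNegative (0≤ℕtoℚ n)}} (ℚ.≤-trans (≤-ceil δ) (ℕtoℚ-mono-≤ (n≤1+n ∣ ↥ δ ∣))) ⟩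
      ℕtoℚ d ℚ.* ℕtoℚ n              ≡⟨ trans (sym (ℕtoℚ-* d n)) (cong ℕtoℚ (trans (*-comm d n) (sym (edgeCount-graph ω)))) ⟩
      ℕtoℚ (edgeCount (graph ω))     ∎
      where open ℚ.≤-Reasoning

theorem1 : ((s t : ℕ) → .{{_ : NonZero s}} → 1 ≤ t → LinThresholdAtMost (Ksub s t) (sigma s))
    × ((s : ℕ) → .{{_ : NonZero s}} → (σ : ℚ) → σ < sigma s →
    Σ ℕ λ t₀ → (t : ℕ) → t ≥ t₀ → LinThresholdGreater (Ksub s t) σ)
theorem1 = (λ s t → sigma-upper s t) , (λ s → sigma-lower s)
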